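{- Let $q$ be a power of a prime $p$, let $0\le j\le q-2$ and $n\ge1$ be integers, and put $k=2j+2+(n-1)(q-1)$ and $m\equiv j+1\pmod{q-1}$. For $\alpha\in\mathbb{Q}$ let $d(\alpha,k)$ denote the multiplicity of $\alpha$ as a slope of the Atkin operator $\mathbf{U}_t$ on $S^1_{k,m}(\Gamma_0(t))$, i.e. the number of roots of $t$-adic valuation $\alpha$ of the characteristic polynomial of $\mathbf{U}_t$ on this space. Let $\alpha\in\mathbb{Q}$. Then $$d(\alpha,k)\le2\left(\frac{\alpha-j-1}{q-1}\right)+1.$$
   Context: $K_\infty$ is the completion of $\mathbb{F}_q(t)$ at $\infty=1/t$, $\mathbb{C}_\infty$ is the completion of an algebraic closure of $K_\infty$, $\Omega=\mathbb{P}^1(\mathbb{C}_\infty)-\mathbb{P}^1(K_\infty)$. $\Gamma_0(t)=\{\begin{pmatrix}a&b\\c&d\end{pmatrix}\in GL_2(\mathbb{F}_q[t]):c\equiv0\bmod t\}$. $S^1_{k,m}(\Gamma_0(t))$ is the space of Drinfeld cusp forms of weight $k$ and type $m$: rigid analytic $\varphi:\Omega\to\mathbb{C}_\infty$ with $\varphi(\gamma z)(\det\gamma)^m(cz+d)^{ -k}=\varphi(z)$ for all $\gamma=\begin{pmatrix}a&b\\c&d\end{pmatrix}\in\Gamma_0(t)$, holomorphic and vanishing at all cusps. $\mathbf{U}_t(\varphi)(z)=\sum_{b\in\mathbb{F}_q}\varphi\left(\frac{z+b}{t}\right)$. For $k,j,n,m$ as in the claim, $S^1_{k,m}(\Gamma_0(t))$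 has dimension $n$ and in a suitable basis (of harmonic cocycles) $\mathbf{U}_t$ has matrix $MD$, where $M=(m_{a,b})_{1\le a,b\le n}$ has entries in $\mathbb{F}_p$, $m_{a,b}=-\left[\binom{j+(n-a)(q-1)}{j+(n-b)(q-1)}+(-1)^{j+1}\binom{j+(n-a)(q-1)}{j+(b-1)(q-1)}\right]$ if $a\ne b$, $m_{a,a}=(-1)^j\binom{j+(n-a)(q-1)}{j+(a-1)(q-1)}$ (with $\binom{x}{y}=0$ if $y>x$), and $D=\mathrm{diag}(t^{s_1},\dots,t^{s_n})$ with $s_i=j+1+(i-1)(q-1)$. Slopes: the characteristic polynomial $P_{\mathbf{U}_t}(X)$ of $\mathbf{U}_t$ on $S^1_{k,m}(\Gamma_0(t))$ has coefficients in $\mathbb{F}_q[t]$; let $v_t$ be the $t$-adic valuation ($v_t(t)=1$), extended to an algebraic closure of $\mathbb{F}_q((t))$. For $\alpha\in\mathbb{Q}$, one says that $\alpha$ is a slope of multiplicity $d(\alpha,k)$ for $\mathbf{U}_t$ if exactly $d(\alpha,k)$ roots of $P_{\mathbf{U}_t}(X)$, counted with multiplicity, have $t$-adic valuation $\alpha$. The root $0$ does not contribute a slope.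
   Formalization: The bound is stated only for α that are slopes, i.e. with d(α,k) ≥ 1; for d(α,k)=0 the claim fails when α is small (e.g. q=3, j=0, n=1, α=−5 gives 0 ≤ −5). -}

module Defs where

open import Algebra.Bundles using (CommutativeRing; RawRing)
open import Algebra.Morphism.Structures using (IsRingHomomorphism)
import Algebra.Definitions.RawMonoid as RawMonoidOps
import Algebra.Definitions.RawSemiring as RawSemiringOps
open import Data.Fin as Fin using (Fin; toℕ; punchIn)
open import Data.Integer as ℤ using (ℤ; -[1+_]) renaming (+_ to pos)
open import Data.List using (List; []; _∷_; _∷ʳ_; map; foldr; filter; length)
open import Data.List.Relation.Unary.All using (All)
open import Data.Nat as ℕ using (ℕ; zero; suc; NonZero; _∸_)
open import Data.Nat.Combinatorics using (_C_)
import Data.Nat.Properties as ℕₚ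
open import Data.Nat.Primality using (Prime; prime⇒nonTrivial)
open import Data.Product using (Σ; ∃; _×_; _,_)
open import Data.Rational as ℚ using (ℚ; 0ℚ; 1ℚ)
import Data.Rational.Properties as ℚₚ
open import Data.Vec.Functional using (Vector)
open import Function using (_⇔_; Inverse)
open import Level using (0ℓ)
open import Relation.Binary.Construct.Add.Supremum.NonStrict ℚ._≤_ using (_≤⁺_)
open import Relation.Binary.PropositionalEquality as ≡ using (_≡_)
open import Relation.Nullary using (¬_; yes; no)
open import Relation.Nullary.Construct.Add.Supremum using (_⁺; ⊤⁺; [_]; ≡-dec)

-- Polynomials are lists of coefficients, constant term first; trailing
-- zeros are allowed, so equality is equality of all coefficients.

module Polynomials (R : RawRing 0ℓ 0ℓ) where
  open RawRing R

  Poly : Set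
  Poly = List Carrier

  coeff : Poly → ℕ → Carrier
  coeff []      _       = 0#
  coeff (a ∷ p) zero    = a
  coeff (a ∷ p) (suc i) = coeff p i

  infix 4 _≈ₚ_
  _≈ₚ_ : Poly → Poly → Set
  p ≈ₚ p′ = ∀ i → coeff p i ≈ coeff p′ i

  infixl 6 _+ₚ_
  infixl 7 _*ₚ_
  infix  8 -ₚ_

  _+ₚ_ : Poly → Poly → Poly
  []      +ₚ p′       = p′
  (a ∷ p) +ₚ []       = a ∷ p
  (a ∷ p) +ₚ (b ∷ p′) = (a + b) ∷ (p +ₚ p′)

  -ₚ_ : Poly → Poly
  -ₚ p = map -_ p

  _*ₚ_ : Poly → Poly → Poly
  []      *ₚ p′ = []
  (a ∷ p) *ₚ p′ = map (a *_) p′ +ₚ (0# ∷ (p *ₚ p′))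

  polyRing : RawRing 0ℓ 0ℓ
  polyRing = record
    { Carrier = Poly
    ; _≈_     = _≈ₚ_
    ; _+_     = _+ₚ_
    ; _*_     = _*ₚ_
    ; -_      = -ₚ_
    ; 0#      = []
    ; 1#      = 1# ∷ []
    }

  X : Poly
  X = 0# ∷ 1# ∷ []

  const : Carrier → Poly
  const a = a ∷ []

  eval : Poly → Carrier → Carrier
  eval []      x = 0#
  eval (a ∷ p) x = a + x * eval p x

  -- ∏ (X - λ) over the given list of λ's
  fromRoots : List Carrier → Poly
  fromRoots = foldr (λ x p → (X +ₚ (-ₚ const x)) *ₚ p) (1# ∷ [])

Matrix : Set → ℕ → Set
Matrix A n = Fin n → Fin n → A

-- Laplace expansion along the first column.

det : (R : RawRing 0ℓ 0ℓ) → ∀ {n} → Matrix (RawRing.Carrier R) n → RawRing.Carrier R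
det R {zero}  A = RawRing.1# R
det R {suc n} A =
  sum (λ i → (- 1#) ^ toℕ i * A i Fin.zero * det R (λ r s → A (punchIn i r) (Fin.suc s)))
  where
  open RawRing R
  open RawSemiringOps rawSemiring using (_^_; sum)

charPoly : (R : RawRing 0ℓ 0ℓ) → ∀ {n} → Matrix (RawRing.Carrier R) n → Polynomials.Poly R
charPoly R A = det polyRing (λ a b → δX a b +ₚ (-ₚ const (A a b)))
  where
  open Polynomials R
  δX : Matrix Poly _
  δX a b with a Fin.≟ b
  ... | yes _ = X
  ... | no  _ = []

-- Inversion is a total operation; the value 0# ⁻¹ is unspecified.

record Field : Set₁ where
  field
    commutativeRing : CommutativeRing 0ℓ 0ℓ
  open CommutativeRing commutativeRing public
  infix 8 _⁻¹
  field
    0≉1        : 0# ≉ 1#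
    _⁻¹        : Carrier → Carrier
    ⁻¹-cong    : ∀ {x y} → x ≈ y → x ⁻¹ ≈ y ⁻¹
    *-inverseʳ : ∀ {x} → x ≉ 0# → x * x ⁻¹ ≈ 1#

  open RawSemiringOps (RawRing.rawSemiring rawRing) public using (sum; _^_)
    renaming (_×_ to _×ᶠ_)
  open Polynomials rawRing public

  infixr 8 _^ℤ_
  _^ℤ_ : Carrier → ℤ → Carrier
  x ^ℤ pos e    = x ^ e
  x ^ℤ -[1+ e ] = (x ⁻¹) ^ suc e

record FiniteField (q : ℕ) : Set₁ where
  field
    𝔽           : Field
    enumeration : Inverse (≡.setoid (Fin q)) (Field.setoid 𝔽)
  open Field 𝔽 public

  element : Fin q → Carrier
  element = Inverse.to enumeration

infixl 6 _+⁺_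
_+⁺_ : ℚ ⁺ → ℚ ⁺ → ℚ ⁺
[ x ] +⁺ [ y ] = [ x ℚ.+ y ]
[ _ ] +⁺ ⊤⁺    = ⊤⁺
⊤⁺    +⁺ _     = ⊤⁺

-- A field containing 𝔽_q and an element T, with a ℚ-valued additive
-- valuation v which is trivial on 𝔽_q.  When v T ≠ 0 the element T is
-- transcendental, and v restricts on 𝔽_q(T) to the T-adic valuation if
-- v T = 1 and to the valuation -deg at ∞ if v T = -1.

record ValuedExtension {q : ℕ} (F : FiniteField q) : Set₁ where
  private module F = FiniteField F
  field
    𝕂 : Field
  open Field 𝕂 public
  field
    ι      : F.Carrier → Carrier
    ι-isRingHomomorphism : IsRingHomomorphism F.rawRing rawRing ι
    T      : Carrier
    v      : Carrier → ℚ ⁺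
    v-cong : ∀ {x y} → x ≈ y → v x ≡ v y
    v-∞    : ∀ x → v x ≡ ⊤⁺ ⇔ x ≈ 0#
    v-*    : ∀ x y → v (x * y) ≡ v x +⁺ v y
    v-+    : ∀ ρ x y → ρ ≤⁺ v x → ρ ≤⁺ v y → ρ ≤⁺ v (x + y)
    v-ι    : ∀ a → a F.≉ F.0# → v (ι a) ≡ [ 0ℚ ]

  fromF[t] : F.Poly → Carrier
  fromF[t] a = eval (map ι a) T

  F⟨T⟩ : Carrier → Set
  F⟨T⟩ x = ∃ λ a → ∃ λ b → fromF[t] b ≉ 0# × x * fromF[t] b ≈ fromF[t] a

  -- The closure of 𝔽_q(T): the completion of 𝔽_q(T) at the place
  -- induced by v, once this closure is known to be complete.
  K : Carrier → Set
  K x = ∀ ρ → ∃ λ y → F⟨T⟩ y × [ ρ ] ≤⁺ v (x - y)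

  AlgebraicOverK : Carrier → Set
  AlgebraicOverK x = ∃ λ cs → All K cs × eval (cs ∷ʳ 1#) x ≈ 0#

  AlgebraicallyClosed : Set
  AlgebraicallyClosed = ∀ c cs → ∃ λ x → eval ((c ∷ cs) ∷ʳ 1#) x ≈ 0#

  Cauchy : (ℕ → Carrier) → Set
  Cauchy s = ∀ ρ → ∃ λ N → ∀ i i′ → N ℕ.≤ i → N ℕ.≤ i′ → [ ρ ] ≤⁺ v (s i - s i′)

  ConvergesTo : (ℕ → Carrier) → Carrier → Set
  ConvergesTo s x = ∀ ρ → ∃ λ N → ∀ i → N ℕ.≤ i → [ ρ ] ≤⁺ v (s i - x)

-- 𝔽_q((t)) is K for the valuation with v T = 1; its algebraic closure
-- carries the unique extension of the t-adic valuation.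

record IsAlgebraicClosureOf𝔽⸨t⸩ {q} {F : FiniteField q} (V : ValuedExtension F) : Set where
  open ValuedExtension V
  field
    v-T                 : v T ≡ [ 1ℚ ]
    K-complete          : ∀ s → (∀ i → K (s i)) → Cauchy s → ∃ (ConvergesTo s)
    algebraic           : ∀ x → AlgebraicOverK x
    algebraicallyClosed : AlgebraicallyClosed

-- K_∞ is K for the valuation with v T = -1, and |x| = q^(- v x).

record IsℂInfinity {q} {F : FiniteField q} (V : ValuedExtension F) : Set where
  open ValuedExtension V
  field
    v-T                 : v T ≡ [ ℚ.- 1ℚ ]
    complete            : ∀ s → Cauchy s → ∃ (ConvergesTo s)
    algebraicallyClosed : AlgebraicallyClosed
    algebraic-dense     : ∀ x ρ → ∃ λ y → AlgebraicOverK y × [ ρ ] ≤⁺ v (x - y)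

-- The units of 𝔽_q[t] are the nonzero constants.

record GL₂F[t] {q} (F : FiniteField q) : Set where
  open FiniteField F
  field
    a b c d : Poly
    δ       : Carrier
    δ≉0     : δ ≉ 0#
    det≈δ   : (a *ₚ d) +ₚ (-ₚ (b *ₚ c)) ≈ₚ const δ

InΓ₀[t] : ∀ {q} {F : FiniteField q} → GL₂F[t] F → Set
InΓ₀[t] {F = F} γ = coeff (GL₂F[t].c γ) 0 ≈ 0#
  where open FiniteField F

module DrinfeldCuspForms {q} {F : FiniteField q} (ℂ∞ : ValuedExtension F) where
  private module F = FiniteField F
  open ValuedExtension ℂ∞

  Ω : Carrier → Set
  Ω z = ¬ K z

  -- A function on Ω is represented by any function on ℂ_∞; only its
  -- values on Ω are ever constrained, and equality is equality on Ω.
  Fun : Set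
  Fun = Carrier → Carrier

  infix 4 _≐_
  _≐_ : Fun → Fun → Set
  φ ≐ ψ = ∀ z → Ω z → φ z ≈ ψ z

  -- The affinoids |z| ≤ q^ρ, |z - x| ≥ q^(-ρ) for all x ∈ K_∞; they
  -- exhaust Ω as ρ grows.
  Ω[_] : ℚ → Carrier → Set
  Ω[ ρ ] z = [ ℚ.- ρ ] ≤⁺ v z × (∀ x → K x → v (z - x) ≤⁺ [ ρ ])

  -- On each affinoid: a uniform limit of rational functions without
  -- poles there.
  RigidAnalytic : Fun → Set
  RigidAnalytic φ = ∀ ρ ε → ∃ λ g → ∃ λ h → ∀ z → Ω[ ρ ] z →
    eval h z ≉ 0# × [ ε ] ≤⁺ v (φ z - eval g z * eval h z ⁻¹)

  slash : ℕ → ℤ → GL₂F[t] F → Fun → Fun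
  slash k m γ φ z =
    φ ((fromF[t] a * z + fromF[t] b) * J ⁻¹) * ι δ ^ℤ m * J ^ℤ (ℤ.- pos k)
    where
    open GL₂F[t] γ
    J = fromF[t] c * z + fromF[t] d

  -- inf { |z - x| : x ∈ K_∞ } ≥ q^ρ
  Im≥_ : ℚ → Carrier → Set
  (Im≥ ρ) z = ∀ x → K x → v (z - x) ≤⁺ [ ℚ.- ρ ]

  -- Behaviour at the cusp ∞ of an analytic function invariant under a
  -- group of translations by a nonzero ideal: the sets Im ≥ q^ρ become
  -- punctured discs around u = 0 for the usual uniformizer u, so that
  -- holomorphy is boundedness and vanishing is convergence to 0.
  BoundedAt∞ : Fun → Set
  BoundedAt∞ φ = ∃ λ ε → ∃ λ ρ → ∀ z → Ω z → (Im≥ ρ) z → [ ε ] ≤⁺ v (φ z)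

  VanishesAt∞ : Fun → Set
  VanishesAt∞ φ = ∀ ε → ∃ λ ρ → ∀ z → Ω z → (Im≥ ρ) z → [ ε ] ≤⁺ v (φ z)

  -- GL₂(𝔽_q[t]) acts transitively on the cusps, so the cusps are
  -- reached by slashing with all its elements.
  record IsCuspForm (k : ℕ) (m : ℤ) (φ : Fun) : Set where
    field
      cong        : ∀ {z w} → Ω z → z ≈ w → φ z ≈ φ w
      analytic    : RigidAnalytic φ
      modular     : ∀ γ → InΓ₀[t] γ → slash k m γ φ ≐ φ
      holomorphic : ∀ γ → BoundedAt∞ (slash k m γ φ)
      vanishing   : ∀ γ → VanishesAt∞ (slash k m γ φ)

  U : Fun → Fun
  U φ z = sum (λ i → φ ((z + ι (F.element i)) * T ⁻¹))

  combination : ∀ {n} → Vector Carrier n → Vector Fun n → Fun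
  combination c e z = sum (λ i → c i * e i z)

  record IsBasis (k : ℕ) (m : ℤ) {n : ℕ} (e : Vector Fun n) : Set where
    field
      cuspForm    : ∀ i → IsCuspForm k m (e i)
      spanning    : ∀ φ → IsCuspForm k m φ → ∃ λ c → φ ≐ combination c e
      independent : ∀ c → combination c e ≐ (λ _ → 0#) → ∀ i → c i ≈ 0#

  IsMatrixOfU : ∀ {n} → Vector Fun n → Matrix Carrier n → Set
  IsMatrixOfU e A = ∀ b → U (e b) ≐ combination (λ a → A a b) e

  UHasMatrix : ℕ → ℤ → ∀ {n} → Matrix Carrier n → Set
  UHasMatrix k m {n} A = Σ (Vector Fun n) λ e → IsBasis k m e × IsMatrixOfU e A

  -- The space is finite-dimensional, and in whichever basis U is
  -- written, P is det (X · 1 - matrix of U).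
  record IsCharPolyOfU (k : ℕ) (m : ℤ) (P : Poly) : Set where
    field
      finiteDimensional : ∃ λ n → Σ (Vector Fun n) (IsBasis k m)
      char-poly         : ∀ {n} (e : Vector Fun n) A → IsBasis k m e → IsMatrixOfU e A →
                          P ≈ₚ charPoly rawRing A

-- Indices run over Fin n, so the index written a in 1 ≤ a ≤ n is
-- suc (toℕ a).

module AtkinMatrix {q} (F : FiniteField q) (n j : ℕ) where
  open FiniteField F

  binom : ℕ → ℕ → Carrier
  binom x y = (x C y) ×ᶠ 1#

  M : Matrix Carrier n
  M a b with a Fin.≟ b
  ... | yes _ = (- 1#) ^ j
                * binom (j ℕ.+ (n ∸ suc (toℕ a)) ℕ.* (q ∸ 1)) (j ℕ.+ toℕ a ℕ.* (q ∸ 1))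
  ... | no  _ = - ( binom (j ℕ.+ (n ∸ suc (toℕ a)) ℕ.* (q ∸ 1))
                          (j ℕ.+ (n ∸ suc (toℕ b)) ℕ.* (q ∸ 1))
                  + (- 1#) ^ suc j
                    * binom (j ℕ.+ (n ∸ suc (toℕ a)) ℕ.* (q ∸ 1)) (j ℕ.+ toℕ b ℕ.* (q ∸ 1)))

  s : Fin n → ℕ
  s i = j ℕ.+ 1 ℕ.+ toℕ i ℕ.* (q ∸ 1)

  -- The product M · diag (t^(s 1), …, t^(s n)), inside an extension of 𝔽_q[t].
  MD : (V : ValuedExtension F) → Matrix (ValuedExtension.Carrier V) n
  MD V a b = ι (M a b) *ⱽ T ^ⱽ s b
    where open ValuedExtension V using (ι; T) renaming (_*_ to _*ⱽ_; _^_ to _^ⱽ_)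

-- Polynomials over 𝔽_q[t], and their images over an extension.

F[t][X] : ∀ {q} → FiniteField q → Set
F[t][X] F = List (FiniteField.Poly F)

baseChange : ∀ {q} {F : FiniteField q} (V : ValuedExtension F) →
             F[t][X] F → ValuedExtension.Poly V
baseChange V = map (ValuedExtension.fromF[t] V)

-- Exactly d roots of P, counted with multiplicity, have valuation α.

HasRootsOfValuation : ∀ {q} {F : FiniteField q} (V : ValuedExtension F) →
                      F[t][X] F → ℚ → ℕ → Set
HasRootsOfValuation V P α d = ∃ λ roots →
    baseChange V P ≈ₚ fromRoots roots
  × length (filter (λ x → ≡-dec ℚₚ._≟_ (v x) [ α ]) roots) ≡ d
  where open ValuedExtension V

_÷ℕ_ : ℚ → (n : ℕ) → .{{NonZero n}} → ℚ
x ÷ℕ n = x ℚ.* (pos 1 ℚ./ n)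

q∸1-nonZero : ∀ {p r q} → Prime p → 1 ℕ.≤ r → q ≡ p ℕ.^ r → NonZero (q ∸ 1)
q∸1-nonZero {p} {r} pp 1≤r ≡.refl =
  ℕ.>-nonZero (ℕₚ.m<n⇒0<n∸m (ℕₚ.<-≤-trans 1<p p≤p^r))
  where
  instance
    nonTrivial : ℕ.NonTrivial p
    nonTrivial = prime⇒nonTrivial pp
    nonZero : NonZero p
    nonZero = ℕ.nonTrivial⇒nonZero p
  1<p : 1 ℕ.< p
  1<p = ℕ.nonTrivial⇒n>1 p
  p≤p^r : p ℕ.≤ p ℕ.^ r
  p≤p^r = ≡.subst (ℕ._≤ p ℕ.^ r) (ℕₚ.*-identityʳ p) (ℕₚ.^-monoʳ-≤ p 1≤r)

-- The Newton polygon of the characteristic polynomial of MD lies above the one with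
-- slopes s_1 < s_2 < …: by Laplace expansion the coefficient of X^i is divisible by
-- t^(s_1 + … + s_(n-i)), since the b-th column of MD is divisible by t^(s_b).  This
-- holds in 𝔽_q[t], into which it is read back from ℂ_∞ because t is transcendental
-- there (v t = -1), and so it holds t-adically.
-- Let N be the number of roots of valuation ≤ α, and g the number of the others.  The
-- coefficient of X^g is, up to sign, the product of the N small roots plus terms of
-- larger valuation, so its valuation is at most N α.  Hence
-- N (j + 1) + (q - 1) N (N - 1) / 2 ≤ N α, and the multiplicity of α is at most N.

{-# OPTIONS --safe #-}

module Submission where

open import Defs
import Algebra.Definitions.RawSemiring as RawSemiringOps
import Algebra.Properties.CommutativeSemigroup as CommutativeSemigroupProperties
import Algebra.Properties.Group as GroupProperties
import Algebra.Properties.Ring as RingProperties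
import Algebra.Properties.Semiring.Exp as Exp
open import Algebra.Bundles using (RawRing)
open import Algebra.Morphism.Structures using (IsRingHomomorphism)
open import Data.Fin as Fin using (Fin; toℕ; punchIn)
open import Data.Integer as ℤ using (ℤ; +_)
open import Data.Integer.Divisibility using (_∣_)
import Data.Integer.Properties as ℤₚ
open import Data.List using (List; []; _∷_; map; filter; length)
open import Data.List.Properties using (filter-reject)
open import Data.Nat as ℕ using (ℕ; zero; suc; z≤n; s≤s; _∸_)
open import Data.Nat.Primality using (Prime)
import Data.Nat.Properties as ℕₚ
open import Data.Nat.Solver using () renaming (module +-*-Solver to ℕSolver)
open import Data.Product using (∃; _×_; _,_)
open import Data.Rational as ℚ using (ℚ; 0ℚ; 1ℚ; _/_)
import Data.Rational.Properties as ℚₚ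
open import Data.Rational.Solver using () renaming (module +-*-Solver to ℚSolver)
open import Data.Rational.Unnormalised as ℚᵘ using (ℚᵘ; mkℚᵘ; *≡*) renaming (_≃_ to _≃ᵘ_)
import Data.Rational.Unnormalised.Properties as ℚᵘₚ
open import Data.Sum using (_⊎_; inj₁; inj₂)
open import Function using (Inverse; _∘_; Equivalence; case_of_)
open import Function.Properties.Inverse using (Inverse⇒Injection) renaming (sym to inverse-sym)
open import Relation.Binary.Construct.Add.Supremum.NonStrict ℚ._≤_ as NonStrict
  using (_≤⁺_; [_]; _≤⊤⁺)
open import Relation.Binary.Definitions using (Decidable)
open import Relation.Binary.PropositionalEquality as ≡ using (_≡_; _≢_)
import Relation.Binary.Reasoning.Setoid as SetoidReasoning
open import Relation.Nullary using (¬_; yes; no; contradiction)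
open import Relation.Nullary.Construct.Add.Supremum using (⊤⁺; [_]; ≡-dec)
open import Relation.Nullary.Decidable using (via-injection)

-- Coefficients of products of polynomials and of ∏ (X - x).

module PolynomialArithmetic (𝕂 : Field) where
  open Field 𝕂
  open SetoidReasoning setoid

  coeff-+ₚ : ∀ p p′ i → coeff (p +ₚ p′) i ≈ coeff p i + coeff p′ i
  coeff-+ₚ []      p′       i       = sym (+-identityˡ _)
  coeff-+ₚ (a ∷ p) []       i       = sym (+-identityʳ _)
  coeff-+ₚ (a ∷ p) (b ∷ p′) zero    = refl
  coeff-+ₚ (a ∷ p) (b ∷ p′) (suc i) = coeff-+ₚ p p′ i

  coeff-scale : ∀ a p i → coeff (map (a *_) p) i ≈ a * coeff p i
  coeff-scale a []      i       = sym (zeroʳ a)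
  coeff-scale a (b ∷ p) zero    = refl
  coeff-scale a (b ∷ p) (suc i) = coeff-scale a p i

  coeff-*ₚ-zero : ∀ p p′ → coeff (p *ₚ p′) 0 ≈ coeff p 0 * coeff p′ 0
  coeff-*ₚ-zero []      p′ = sym (zeroˡ _)
  coeff-*ₚ-zero (a ∷ p) p′ = begin
    coeff (map (a *_) p′ +ₚ (0# ∷ (p *ₚ p′))) 0  ≈⟨ coeff-+ₚ (map (a *_) p′) _ 0 ⟩
    coeff (map (a *_) p′) 0 + 0#                 ≈⟨ +-identityʳ _ ⟩
    coeff (map (a *_) p′) 0                      ≈⟨ coeff-scale a p′ 0 ⟩
    a * coeff p′ 0                               ∎

  coeff-∷-*ₚ-suc : ∀ a p p′ i →
    coeff ((a ∷ p) *ₚ p′) (suc i) ≈ a * coeff p′ (suc i) + coeff (p *ₚ p′) i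
  coeff-∷-*ₚ-suc a p p′ i =
    trans (coeff-+ₚ (map (a *_) p′) _ (suc i)) (+-congʳ (coeff-scale a p′ (suc i)))

  -- A list of zeros need not be `[]`, hence the induction; it disposes of the tail of a constant
  -- polynomial in `coeff-constant-*ₚ`.
  zero-*ₚ : ∀ p p′ → (∀ i → coeff p i ≈ 0#) → ∀ i → coeff (p *ₚ p′) i ≈ 0#
  zero-*ₚ p       p′ p≈0 zero    =
    trans (coeff-*ₚ-zero p p′) (trans (*-congʳ (p≈0 0)) (zeroˡ _))
  zero-*ₚ []      p′ p≈0 (suc i) = refl
  zero-*ₚ (a ∷ p) p′ p≈0 (suc i) = begin
    coeff ((a ∷ p) *ₚ p′) (suc i)               ≈⟨ coeff-∷-*ₚ-suc a p p′ i ⟩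
    a * coeff p′ (suc i) + coeff (p *ₚ p′) i
      ≈⟨ +-cong (*-congʳ (p≈0 0)) (zero-*ₚ p p′ (p≈0 ∘ suc) i) ⟩
    0# * coeff p′ (suc i) + 0#                  ≈⟨ +-identityʳ _ ⟩
    0# * coeff p′ (suc i)                       ≈⟨ zeroˡ _ ⟩
    0#                                          ∎

  coeff-constant-*ₚ : ∀ p p′ → (∀ i → coeff p (suc i) ≈ 0#) →
    ∀ i → coeff (p *ₚ p′) i ≈ coeff p 0 * coeff p′ i
  coeff-constant-*ₚ p       p′ p-const zero    = coeff-*ₚ-zero p p′
  coeff-constant-*ₚ []      p′ p-const (suc i) = sym (zeroˡ _)
  coeff-constant-*ₚ (a ∷ p) p′ p-const (suc i) =
    trans (coeff-∷-*ₚ-suc a p p′ i) (trans (+-congˡ (zero-*ₚ p p′ p-const i)) (+-identityʳ _))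

  -- The factors X - x of `fromRoots` and the entries of the characteristic matrix are both linear,
  -- so this recursion drives the lower and the upper estimate of the coefficients alike.
  coeff-linear-*ₚ : ∀ p p′ → (∀ i → coeff p (2 ℕ.+ i) ≈ 0#) →
    ∀ i → coeff (p *ₚ p′) (suc i) ≈ coeff p 0 * coeff p′ (suc i) + coeff p 1 * coeff p′ i
  coeff-linear-*ₚ []      p′ p-lin i =
    sym (trans (+-cong (zeroˡ _) (zeroˡ _)) (+-identityʳ 0#))
  coeff-linear-*ₚ (a ∷ p) p′ p-lin i =
    trans (coeff-∷-*ₚ-suc a p p′ i) (+-congˡ (coeff-constant-*ₚ p p′ p-lin i))

  coeff-[X-_]*ₚ-zero : ∀ x p → coeff ((X +ₚ (-ₚ const x)) *ₚ p) 0 ≈ - x * coeff p 0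
  coeff-[X- x ]*ₚ-zero p =
    trans (coeff-*ₚ-zero (X +ₚ (-ₚ const x)) p) (*-congʳ (+-identityˡ (- x)))

  coeff-[X-_]*ₚ-suc : ∀ x p i →
    coeff ((X +ₚ (-ₚ const x)) *ₚ p) (suc i) ≈ - x * coeff p (suc i) + coeff p i
  coeff-[X- x ]*ₚ-suc p i =
    trans (coeff-linear-*ₚ (X +ₚ (-ₚ const x)) p (λ _ → refl) i)
          (+-cong (*-congʳ (+-identityˡ (- x))) (*-identityˡ _))

  coeff-fromRoots->length : ∀ xs i → length xs ℕ.< i → coeff (fromRoots xs) i ≈ 0#
  coeff-fromRoots->length []       (suc i) _         = refl
  coeff-fromRoots->length (x ∷ xs) (suc i) (s≤s n<i) = begin
    coeff (fromRoots (x ∷ xs)) (suc i)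
      ≈⟨ coeff-[X- x ]*ₚ-suc (fromRoots xs) i ⟩
    - x * coeff (fromRoots xs) (suc i) + coeff (fromRoots xs) i
      ≈⟨ +-cong (*-congˡ (coeff-fromRoots->length xs (suc i) (ℕₚ.m≤n⇒m≤1+n n<i)))
                (coeff-fromRoots->length xs i n<i) ⟩
    - x * 0# + 0#  ≈⟨ +-identityʳ _ ⟩
    - x * 0#       ≈⟨ zeroʳ _ ⟩
    0#             ∎

  fromRoots-monic : ∀ xs → coeff (fromRoots xs) (length xs) ≈ 1#
  fromRoots-monic []       = refl
  fromRoots-monic (x ∷ xs) = begin
    coeff (fromRoots (x ∷ xs)) (suc (length xs))
      ≈⟨ coeff-[X- x ]*ₚ-suc (fromRoots xs) (length xs) ⟩
    - x * coeff (fromRoots xs) (suc (length xs)) + coeff (fromRoots xs) (length xs)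
      ≈⟨ +-cong (*-congˡ (coeff-fromRoots->length xs _ ℕₚ.≤-refl)) (fromRoots-monic xs) ⟩
    - x * 0# + 1#  ≈⟨ +-congʳ (zeroʳ _) ⟩
    0# + 1#        ≈⟨ +-identityˡ 1# ⟩
    1#             ∎

_≈?_ : ∀ {q} {F : FiniteField q} → Decidable (FiniteField._≈_ F)
_≈?_ {F = F} = via-injection (Inverse⇒Injection (inverse-sym (FiniteField.enumeration F))) Fin._≟_

-- Inequalities between valuations.

module Valuation {q} {F : FiniteField q} (V : ValuedExtension F) where
  private module F = FiniteField F
  open ValuedExtension V
  open RingProperties ring using (-1*x≈-x)
  open IsRingHomomorphism ι-isRingHomomorphism
  open SetoidReasoning setoid

  AtLeast : ℚ → Carrier → Set
  AtLeast ρ x = [ ρ ] ≤⁺ v x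

  -- Strictness is witnessed by a larger rational lower bound. This includes the value ⊤⁺, and it
  -- lets `v-+`, which speaks of ≤ only, yield strict inequalities for sums.
  Exceeds : ℚ → Carrier → Set
  Exceeds ρ x = ∃ λ ρ′ → ρ ℚ.< ρ′ × AtLeast ρ′ x

  atLeast-weaken : ∀ {ρ ρ′ x} → ρ ℚ.≤ ρ′ → AtLeast ρ′ x → AtLeast ρ x
  atLeast-weaken ρ≤ρ′ = NonStrict.≤⁺-trans ℚₚ.≤-trans [ ρ≤ρ′ ]

  atLeast-cong : ∀ {ρ x y} → x ≈ y → AtLeast ρ x → AtLeast ρ y
  atLeast-cong x≈y = ≡.subst ([ _ ] ≤⁺_) (v-cong x≈y)

  exceeds-cong : ∀ {ρ x y} → x ≈ y → Exceeds ρ x → Exceeds ρ y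
  exceeds-cong x≈y (ρ′ , ρ<ρ′ , le) = ρ′ , ρ<ρ′ , atLeast-cong x≈y le

  exceeds⇒atLeast : ∀ {ρ x} → Exceeds ρ x → AtLeast ρ x
  exceeds⇒atLeast (ρ′ , ρ<ρ′ , le) = atLeast-weaken (ℚₚ.<⇒≤ ρ<ρ′) le

  atLeast-v≡ : ∀ {ρ x} → v x ≡ [ ρ ] → AtLeast ρ x
  atLeast-v≡ eq = NonStrict.≤⁺-reflexive-≡ ℚₚ.≤-reflexive (≡.sym eq)

  atLeast-0 : ∀ {ρ x} → x ≈ 0# → AtLeast ρ x
  atLeast-0 {x = x} x≈0 = ≡.subst ([ _ ] ≤⁺_) (≡.sym (Equivalence.from (v-∞ x) x≈0)) (_ ≤⊤⁺)

  exceeds-0 : ∀ {ρ x} → x ≈ 0# → Exceeds ρ x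
  exceeds-0 {ρ} x≈0 = ρ ℚ.+ 1ℚ , ρ<ρ+1 , atLeast-0 x≈0
    where
    ρ<ρ+1 : ρ ℚ.< ρ ℚ.+ 1ℚ
    ρ<ρ+1 = ≡.subst (ℚ._< ρ ℚ.+ 1ℚ) (ℚₚ.+-identityʳ ρ) (ℚₚ.+-monoʳ-< ρ (ℚₚ.positive⁻¹ 1ℚ))

  +⁺-mono : ∀ {ρ σ x y} → [ ρ ] ≤⁺ x → [ σ ] ≤⁺ y → [ ρ ℚ.+ σ ] ≤⁺ x +⁺ y
  +⁺-mono [ p ]     [ p′ ]    = [ ℚₚ.+-mono-≤ p p′ ]
  +⁺-mono [ p ]     (_ ≤⊤⁺)   = _ ≤⊤⁺
  +⁺-mono (_ ≤⊤⁺)   _         = _ ≤⊤⁺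

  +⁺-cancelˡ : ∀ {ρ σ x} → [ ρ ℚ.+ σ ] ≤⁺ [ ρ ] +⁺ x → [ σ ] ≤⁺ x
  +⁺-cancelˡ {ρ} {σ} {[ τ ]} [ p ] =
    [ ≡.subst₂ ℚ._≤_ (cancel σ) (cancel τ) (ℚₚ.+-monoʳ-≤ (ℚ.- ρ) p) ]
    where
    cancel : ∀ τ → ℚ.- ρ ℚ.+ (ρ ℚ.+ τ) ≡ τ
    cancel τ = ≡.trans (≡.sym (ℚₚ.+-assoc (ℚ.- ρ) ρ τ))
      (≡.trans (≡.cong (ℚ._+ τ) (ℚₚ.+-inverseˡ ρ)) (ℚₚ.+-identityˡ τ))
  +⁺-cancelˡ {x = ⊤⁺} _ = _ ≤⊤⁺

  atLeast-* : ∀ {ρ σ x y} → AtLeast ρ x → AtLeast σ y → AtLeast (ρ ℚ.+ σ) (x * y)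
  atLeast-* {x = x} {y} px py = ≡.subst ([ _ ] ≤⁺_) (≡.sym (v-* x y)) (+⁺-mono px py)

  exceeds-*ʳ : ∀ {ρ σ x y} → AtLeast ρ x → Exceeds σ y → Exceeds (ρ ℚ.+ σ) (x * y)
  exceeds-*ʳ {ρ} px (σ′ , σ<σ′ , py) = ρ ℚ.+ σ′ , ℚₚ.+-monoʳ-< ρ σ<σ′ , atLeast-* px py

  exceeds-*ˡ : ∀ {ρ σ x y} → Exceeds ρ x → AtLeast σ y → Exceeds (ρ ℚ.+ σ) (x * y)
  exceeds-*ˡ {σ = σ} (ρ′ , ρ<ρ′ , px) py = ρ′ ℚ.+ σ , ℚₚ.+-monoˡ-< σ ρ<ρ′ , atLeast-* px py

  -- A lower bound for `v x` could not be cancelled; the exact finite value is subtracted from both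
  -- sides.
  exceeds-cancel : ∀ {ρ σ x y} → v x ≡ [ ρ ] → Exceeds (ρ ℚ.+ σ) (x * y) → Exceeds σ y
  exceeds-cancel {ρ} {σ} {x} {y} vx≡ρ (τ , ρ+σ<τ , p) =
    τ ℚ.- ρ , ≡.subst (ℚ._< τ ℚ.- ρ) (shift σ) (ℚₚ.+-monoˡ-< (ℚ.- ρ) ρ+σ<τ) ,
    +⁺-cancelˡ (≡.subst₂ _≤⁺_ (≡.cong [_] (≡.sym (unshift τ)))
                         (≡.trans (v-* x y) (≡.cong (_+⁺ v y) vx≡ρ)) p)
    where
    unshift : ∀ τ → ρ ℚ.+ (τ ℚ.- ρ) ≡ τ
    unshift τ = ≡.trans (≡.cong (ρ ℚ.+_) (ℚₚ.+-comm τ (ℚ.- ρ)))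
      (≡.trans (≡.sym (ℚₚ.+-assoc ρ (ℚ.- ρ) τ))
        (≡.trans (≡.cong (ℚ._+ τ) (ℚₚ.+-inverseʳ ρ)) (ℚₚ.+-identityˡ τ)))
    shift : ∀ σ → (ρ ℚ.+ σ) ℚ.- ρ ≡ σ
    shift σ = ≡.trans (ℚₚ.+-assoc ρ σ (ℚ.- ρ)) (unshift σ)

  exceeds-+ : ∀ {ρ x y} → Exceeds ρ x → Exceeds ρ y → Exceeds ρ (x + y)
  exceeds-+ {ρ} {x} {y} (σ , ρ<σ , px) (τ , ρ<τ , py) with ℚₚ.≤-total σ τ
  ... | inj₁ σ≤τ = σ , ρ<σ , v-+ [ σ ] x y px (atLeast-weaken σ≤τ py)
  ... | inj₂ τ≤σ = τ , ρ<τ , v-+ [ τ ] x y (atLeast-weaken τ≤σ px) py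

  v-ι-1 : v (ι F.1#) ≡ [ 0ℚ ]
  v-ι-1 = v-ι F.1# (F.0≉1 ∘ F.sym)

  v-1 : v 1# ≡ [ 0ℚ ]
  v-1 = ≡.trans (v-cong (sym 1#-homo)) v-ι-1

  -- The element - 1 is the image of a nonzero constant, and `v` is trivial on those.
  v-[-1] : v (- 1#) ≡ [ 0ℚ ]
  v-[-1] = ≡.trans (v-cong (trans (-‿cong (sym 1#-homo)) (sym (-‿homo F.1#))))
                   (v-ι (F.- F.1#) -1≉0)
    where
    -1≉0 : (F.- F.1#) F.≉ F.0#
    -1≉0 -1≈0 = F.0≉1 (F.trans (F.sym (F.-‿inverseʳ F.1#))
                               (F.trans (F.+-congˡ -1≈0) (F.+-identityʳ F.1#)))

  v-neg : ∀ x → v (- x) ≡ v x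
  v-neg x = ≡.trans (v-cong (sym (-1*x≈-x x))) (≡.trans (v-* (- 1#) x)
    (≡.trans (≡.cong (_+⁺ v x) v-[-1]) (0+⁺ (v x))))
    where
    0+⁺ : ∀ y → [ 0ℚ ] +⁺ y ≡ y
    0+⁺ [ y ] = ≡.cong [_] (ℚₚ.+-identityˡ y)
    0+⁺ ⊤⁺    = ≡.refl

  exceeds-neg : ∀ {ρ x} → Exceeds ρ x → Exceeds ρ (- x)
  exceeds-neg {x = x} (σ , ρ<σ , p) = σ , ρ<σ , ≡.subst ([ σ ] ≤⁺_) (≡.sym (v-neg x)) p

  -- Write y as - x + (x + y): a summand of large valuation does not decide whether a sum has large
  -- valuation. This isolates the dominant term of a coefficient.
  exceeds-+-cancelˡ : ∀ {ρ x y} → Exceeds ρ x → Exceeds ρ (x + y) → Exceeds ρ y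
  exceeds-+-cancelˡ {x = x} {y} px pxy = exceeds-cong -x+[x+y]≈y (exceeds-+ (exceeds-neg px) pxy)
    where
    -x+[x+y]≈y : - x + (x + y) ≈ y
    -x+[x+y]≈y = begin
      - x + (x + y)  ≈⟨ +-assoc (- x) x y ⟨
      - x + x + y    ≈⟨ +-congʳ (-‿inverseˡ x) ⟩
      0# + y         ≈⟨ +-identityˡ y ⟩
      y              ∎

  exceeds-+-cancelʳ : ∀ {ρ x y} → Exceeds ρ y → Exceeds ρ (x + y) → Exceeds ρ x
  exceeds-+-cancelʳ py pxy = exceeds-+-cancelˡ py (exceeds-cong (+-comm _ _) pxy)

  exceeds⇒< : ∀ {ρ σ x} → v x ≡ [ σ ] → Exceeds ρ x → ρ ℚ.< σ
  exceeds⇒< vx≡σ (ρ′ , ρ<ρ′ , p) =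
    ℚₚ.<-≤-trans ρ<ρ′ (NonStrict.[≤]-injective (≡.subst ([ ρ′ ] ≤⁺_) vx≡σ p))

  -- `¬ Exceeds σ x` serves as the upper bound v x ≤ σ: a rational lower bound beyond σ would
  -- witness `Exceeds`.
  atLeast∧¬exceeds : ∀ {ρ σ x} → AtLeast ρ x → ¬ Exceeds σ x → ρ ℚ.≤ σ
  atLeast∧¬exceeds p ¬e = ℚₚ.≮⇒≥ (λ σ<ρ → ¬e (_ , σ<ρ , p))

-- The embedding of ℕ into ℚ.

module ℕ⇒ℚ where
  open ℚᵘₚ.≃-Reasoning

  fromℕ : ℕ → ℚ
  fromℕ n = + n / 1

  private
    fromℕᵘ : ℕ → ℚᵘ
    fromℕᵘ n = mkℚᵘ (+ n) 0

    toℚᵘ-fromℕ : ∀ n → ℚ.toℚᵘ (fromℕ n) ≃ᵘ fromℕᵘ n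
    toℚᵘ-fromℕ n = ℚₚ.toℚᵘ-fromℚᵘ (fromℕᵘ n)

  fromℕ-+ : ∀ m n → fromℕ (m ℕ.+ n) ≡ fromℕ m ℚ.+ fromℕ n
  fromℕ-+ m n = ℚₚ.toℚᵘ-injective (begin
    ℚ.toℚᵘ (fromℕ (m ℕ.+ n))                    ≈⟨ toℚᵘ-fromℕ (m ℕ.+ n) ⟩
    fromℕᵘ (m ℕ.+ n)
      ≈⟨ *≡* (≡.cong (ℤ._* + 1) (≡.sym (≡.cong₂ ℤ._+_ (ℤₚ.*-identityʳ (+ m)) (ℤₚ.*-identityʳ (+ n))))) ⟩
    fromℕᵘ m ℚᵘ.+ fromℕᵘ n                      ≈⟨ ℚᵘₚ.+-cong (toℚᵘ-fromℕ m) (toℚᵘ-fromℕ n) ⟨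
    ℚ.toℚᵘ (fromℕ m) ℚᵘ.+ ℚ.toℚᵘ (fromℕ n)      ≈⟨ ℚₚ.toℚᵘ-homo-+ (fromℕ m) (fromℕ n) ⟨
    ℚ.toℚᵘ (fromℕ m ℚ.+ fromℕ n)                ∎)

  fromℕ-* : ∀ m n → fromℕ (m ℕ.* n) ≡ fromℕ m ℚ.* fromℕ n
  fromℕ-* m n = ℚₚ.toℚᵘ-injective (begin
    ℚ.toℚᵘ (fromℕ (m ℕ.* n))                    ≈⟨ toℚᵘ-fromℕ (m ℕ.* n) ⟩
    fromℕᵘ (m ℕ.* n)                            ≈⟨ *≡* (≡.cong (ℤ._* + 1) (ℤₚ.pos-* m n)) ⟩
    fromℕᵘ m ℚᵘ.* fromℕᵘ n                      ≈⟨ ℚᵘₚ.*-cong (toℚᵘ-fromℕ m) (toℚᵘ-fromℕ n) ⟨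
    ℚ.toℚᵘ (fromℕ m) ℚᵘ.* ℚ.toℚᵘ (fromℕ n)      ≈⟨ ℚₚ.toℚᵘ-homo-* (fromℕ m) (fromℕ n) ⟨
    ℚ.toℚᵘ (fromℕ m ℚ.* fromℕ n)                ∎)

  fromℕ-mono-≤ : ∀ {m n} → m ℕ.≤ n → fromℕ m ℚ.≤ fromℕ n
  fromℕ-mono-≤ {m} {n} m≤n = ≡.subst₂ ℚ._≤_ (ℚₚ.+-identityʳ (fromℕ m))
    (≡.trans (≡.sym (fromℕ-+ m (n ∸ m))) (≡.cong fromℕ (ℕₚ.m+[n∸m]≡n m≤n)))
    (ℚₚ.+-monoʳ-≤ (fromℕ m) (ℚₚ.nonNegative⁻¹ (fromℕ (n ∸ m)) {{ℚₚ.normalize-nonNeg (n ∸ m) 1}}))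

open ℕ⇒ℚ

-- Divisibility by powers of t inside the image of 𝔽_q[t].

module MonomialMultiples {q} (F : FiniteField q) where
  open FiniteField F using (Poly; 0#)

  -- Multiplication by t^S is done on coefficient lists, outside any extension, so that the same
  -- polynomial can be evaluated in ℂ_∞ and over 𝔽_q((t)).
  t^_·_ : ℕ → Poly → Poly
  t^ zero  · h = h
  t^ suc S · h = 0# ∷ (t^ S · h)

module ConstantField {q} {F : FiniteField q} (V : ValuedExtension F) where
  private module F = FiniteField F
  open ValuedExtension V hiding (zero)
  open RingProperties ring using (-‿distribʳ-*; -0#≈0#; -‿+-comm)
  open IsRingHomomorphism ι-isRingHomomorphism
  open Exp semiring using (^-homo-*)
  open CommutativeSemigroupProperties *-commutativeSemigroup
    using (x∙yz≈y∙xz) renaming (interchange to *-interchange)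
  open CommutativeSemigroupProperties +-commutativeSemigroup
    using () renaming (interchange to +-interchange)
  open SetoidReasoning setoid
  open MonomialMultiples F
  open Valuation V

  fromF[t]-zero : ∀ h → (∀ i → F.coeff h i F.≈ F.0#) → fromF[t] h ≈ 0#
  fromF[t]-zero []      h≈0 = refl
  fromF[t]-zero (a ∷ h) h≈0 = begin
    ι a + T * fromF[t] h  ≈⟨ +-cong (⟦⟧-cong (h≈0 0)) (*-congˡ (fromF[t]-zero h (h≈0 ∘ suc))) ⟩
    ι F.0# + T * 0#       ≈⟨ +-cong 0#-homo (zeroʳ T) ⟩
    0# + 0#               ≈⟨ +-identityʳ 0# ⟩
    0#                    ∎

  fromF[t]-+ : ∀ g h → fromF[t] (g F.+ₚ h) ≈ fromF[t] g + fromF[t] h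
  fromF[t]-+ []      h       = sym (+-identityˡ _)
  fromF[t]-+ (a ∷ g) []      = sym (+-identityʳ _)
  fromF[t]-+ (a ∷ g) (b ∷ h) = begin
    ι (a F.+ b) + T * fromF[t] (g F.+ₚ h)
      ≈⟨ +-cong (+-homo a b) (*-congˡ (fromF[t]-+ g h)) ⟩
    (ι a + ι b) + T * (fromF[t] g + fromF[t] h)
      ≈⟨ +-congˡ (distribˡ T (fromF[t] g) (fromF[t] h)) ⟩
    (ι a + ι b) + (T * fromF[t] g + T * fromF[t] h)
      ≈⟨ +-interchange (ι a) (ι b) _ _ ⟩
    (ι a + T * fromF[t] g) + (ι b + T * fromF[t] h)  ∎

  fromF[t]-neg : ∀ h → fromF[t] (F.-ₚ h) ≈ - fromF[t] h
  fromF[t]-neg []      = sym -0#≈0#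
  fromF[t]-neg (a ∷ h) = begin
    ι (F.- a) + T * fromF[t] (F.-ₚ h)  ≈⟨ +-cong (-‿homo a) (*-congˡ (fromF[t]-neg h)) ⟩
    - ι a + T * - fromF[t] h           ≈⟨ +-congˡ (-‿distribʳ-* T (fromF[t] h)) ⟨
    - ι a + - (T * fromF[t] h)         ≈⟨ -‿+-comm (ι a) (T * fromF[t] h) ⟩
    - (ι a + T * fromF[t] h)           ∎

  fromF[t]-scale : ∀ a h → fromF[t] (map (a F.*_) h) ≈ ι a * fromF[t] h
  fromF[t]-scale a []      = sym (zeroʳ (ι a))
  fromF[t]-scale a (b ∷ h) = begin
    ι (a F.* b) + T * fromF[t] (map (a F.*_) h)
      ≈⟨ +-cong (*-homo a b) (*-congˡ (fromF[t]-scale a h)) ⟩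
    ι a * ι b + T * (ι a * fromF[t] h)
      ≈⟨ +-congˡ (x∙yz≈y∙xz T (ι a) (fromF[t] h)) ⟩
    ι a * ι b + ι a * (T * fromF[t] h)
      ≈⟨ distribˡ (ι a) (ι b) (T * fromF[t] h) ⟨
    ι a * (ι b + T * fromF[t] h)  ∎

  fromF[t]-shift : ∀ h → fromF[t] (F.0# ∷ h) ≈ T * fromF[t] h
  fromF[t]-shift h = trans (+-congʳ 0#-homo) (+-identityˡ _)

  fromF[t]-* : ∀ g h → fromF[t] (g F.*ₚ h) ≈ fromF[t] g * fromF[t] h
  fromF[t]-* []      h = sym (zeroˡ _)
  fromF[t]-* (a ∷ g) h = begin
    fromF[t] (map (a F.*_) h F.+ₚ (F.0# ∷ (g F.*ₚ h)))
      ≈⟨ fromF[t]-+ (map (a F.*_) h) _ ⟩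
    fromF[t] (map (a F.*_) h) + fromF[t] (F.0# ∷ (g F.*ₚ h))
      ≈⟨ +-cong (fromF[t]-scale a h) (fromF[t]-shift (g F.*ₚ h)) ⟩
    ι a * fromF[t] h + T * fromF[t] (g F.*ₚ h)
      ≈⟨ +-congˡ (*-congˡ (fromF[t]-* g h)) ⟩
    ι a * fromF[t] h + T * (fromF[t] g * fromF[t] h)
      ≈⟨ +-congˡ (*-assoc T (fromF[t] g) (fromF[t] h)) ⟨
    ι a * fromF[t] h + T * fromF[t] g * fromF[t] h
      ≈⟨ distribʳ (fromF[t] h) (ι a) (T * fromF[t] g) ⟨
    (ι a + T * fromF[t] g) * fromF[t] h  ∎

  fromF[t]-const : ∀ a → fromF[t] (F.const a) ≈ ι a
  fromF[t]-const a = trans (+-congˡ (zeroʳ T)) (+-identityʳ (ι a))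

  fromF[t]-t^ : ∀ S h → fromF[t] (t^ S · h) ≈ T ^ S * fromF[t] h
  fromF[t]-t^ zero    h = sym (*-identityˡ _)
  fromF[t]-t^ (suc S) h = begin
    fromF[t] (F.0# ∷ (t^ S · h))  ≈⟨ fromF[t]-shift (t^ S · h) ⟩
    T * fromF[t] (t^ S · h)       ≈⟨ *-congˡ (fromF[t]-t^ S h) ⟩
    T * (T ^ S * fromF[t] h)      ≈⟨ *-assoc T (T ^ S) _ ⟨
    T ^ suc S * fromF[t] h        ∎

  -- A record rather than a Σ-type, so that S is recovered from the type.
  record [t^_] (S : ℕ) (x : Carrier) : Set where
    constructor _,_
    field
      cofactor : F.Poly
      equation : x ≈ T ^ S * fromF[t] cofactor

  [t^]-cong : ∀ {S x y} → x ≈ y → [t^ S ] x → [t^ S ] y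
  [t^]-cong x≈y (h , eq) = h , trans (sym x≈y) eq

  [t^]-0 : ∀ {S x} → x ≈ 0# → [t^ S ] x
  [t^]-0 {S} x≈0 = [] , trans x≈0 (sym (zeroʳ (T ^ S)))

  [t^]-+ : ∀ {S x y} → [t^ S ] x → [t^ S ] y → [t^ S ] (x + y)
  [t^]-+ {S} (g , x≈) (h , y≈) = g F.+ₚ h ,
    trans (+-cong x≈ y≈) (trans (sym (distribˡ (T ^ S) _ _)) (*-congˡ (sym (fromF[t]-+ g h))))

  [t^]-neg : ∀ {S x} → [t^ S ] x → [t^ S ] (- x)
  [t^]-neg {S} (h , x≈) = F.-ₚ h ,
    trans (-‿cong x≈) (trans (-‿distribʳ-* (T ^ S) _) (*-congˡ (sym (fromF[t]-neg h))))

  [t^]-* : ∀ {S S′ x y} → [t^ S ] x → [t^ S′ ] y → [t^ S ℕ.+ S′ ] (x * y)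
  [t^]-* {S} {S′} {x} {y} (g , x≈) (h , y≈) = g F.*ₚ h , (begin
    x * y                                            ≈⟨ *-cong x≈ y≈ ⟩
    (T ^ S * fromF[t] g) * (T ^ S′ * fromF[t] h)
      ≈⟨ *-interchange (T ^ S) (fromF[t] g) (T ^ S′) (fromF[t] h) ⟩
    (T ^ S * T ^ S′) * (fromF[t] g * fromF[t] h)
      ≈⟨ *-cong (^-homo-* T S S′) (fromF[t]-* g h) ⟨
    T ^ (S ℕ.+ S′) * fromF[t] (g F.*ₚ h)              ∎)

  -- The surplus power of T moves into the cofactor, which thereby stays a polynomial over 𝔽_q.
  [t^]-weaken : ∀ {S S′ x} → S ℕ.≤ S′ → [t^ S′ ] x → [t^ S ] x
  [t^]-weaken {S} {S′} {x} S≤S′ (h , x≈) = t^ (S′ ∸ S) · h , (begin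
    x                                        ≈⟨ x≈ ⟩
    T ^ S′ * fromF[t] h
      ≡⟨ ≡.cong (λ R → T ^ R * fromF[t] h) (ℕₚ.m+[n∸m]≡n S≤S′) ⟨
    T ^ (S ℕ.+ (S′ ∸ S)) * fromF[t] h        ≈⟨ *-congʳ (^-homo-* T S (S′ ∸ S)) ⟩
    T ^ S * T ^ (S′ ∸ S) * fromF[t] h        ≈⟨ *-assoc (T ^ S) _ _ ⟩
    T ^ S * (T ^ (S′ ∸ S) * fromF[t] h)      ≈⟨ *-congˡ (fromF[t]-t^ (S′ ∸ S) h) ⟨
    T ^ S * fromF[t] (t^ (S′ ∸ S) · h)       ∎)

  [t^]-ι : ∀ a S → [t^ S ] (ι a * T ^ S)
  [t^]-ι a S = F.const a , trans (*-comm (ι a) (T ^ S)) (*-congˡ (sym (fromF[t]-const a)))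

  [t^0]-1 : [t^ 0 ] 1#
  [t^0]-1 = F.const F.1# ,
    sym (trans (*-identityˡ _) (trans (fromF[t]-const F.1#) 1#-homo))

  -- `v-ι` speaks of nonzero constants; decidable equality in the finite field separates off a = 0,
  -- whose image has value ⊤⁺.
  atLeast-ι : ∀ a → AtLeast 0ℚ (ι a)
  atLeast-ι a with _≈?_ {F = F} a F.0#
  ... | yes a≈0 = atLeast-0 (trans (⟦⟧-cong a≈0) 0#-homo)
  ... | no  a≉0 = atLeast-v≡ (v-ι a a≉0)

  -- By Horner's scheme a polynomial in T has valuation at least 0, and each prepended zero
  -- multiplies by T, adding 1.
  v[T]=1⇒v-t^ : v T ≡ [ 1ℚ ] → ∀ S h → AtLeast (+ S / 1) (fromF[t] (t^ S · h))
  v[T]=1⇒v-t^ v-T zero    []      = atLeast-0 refl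
  v[T]=1⇒v-t^ v-T zero    (a ∷ h) = v-+ [ 0ℚ ] _ _ (atLeast-ι a)
    (atLeast-weaken (ℚₚ.nonNegative⁻¹ 1ℚ) (atLeast-* (atLeast-v≡ v-T) (v[T]=1⇒v-t^ v-T zero h)))
  v[T]=1⇒v-t^ v-T (suc S) h       = atLeast-cong (sym (fromF[t]-shift (t^ S · h)))
    (≡.subst (λ ρ → AtLeast ρ (T * fromF[t] (t^ S · h))) (≡.sym (fromℕ-+ 1 S))
             (atLeast-* (atLeast-v≡ v-T) (v[T]=1⇒v-t^ v-T S h)))

  -- Here `v` is -deg. Once a tail has valuation at most 0, multiplying by T brings it down to at
  -- most -1, and a constant, of valuation at least 0, cannot cancel it.
  v[T]=-1⇒zero⊎v≤0 : v T ≡ [ ℚ.- 1ℚ ] → ∀ h →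
    (∀ i → F.coeff h i F.≈ F.0#) ⊎ (¬ Exceeds 0ℚ (fromF[t] h))
  v[T]=-1⇒zero⊎v≤0 v-T []      = inj₁ (λ _ → F.refl)
  v[T]=-1⇒zero⊎v≤0 v-T (a ∷ h) with v[T]=-1⇒zero⊎v≤0 v-T h | _≈?_ {F = F} a F.0#
  ... | inj₁ h≈0 | yes a≈0 = inj₁ λ { zero → a≈0 ; (suc i) → h≈0 i }
  ... | inj₁ h≈0 | no  a≉0 = inj₂ λ e → ℚₚ.<-irrefl ≡.refl
    (exceeds⇒< (v-ι a a≉0) (exceeds-cong ι≈ e))
    where
    ι≈ : fromF[t] (a ∷ h) ≈ ι a
    ι≈ = trans (+-congˡ (trans (*-congˡ (fromF[t]-zero h h≈0)) (zeroʳ T))) (+-identityʳ (ι a))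
  ... | inj₂ ¬e  | _       = inj₂ λ { (ρ , 0<ρ , p) → ¬e (exceeds-cancel v-T
    (exceeds-+-cancelˡ (0ℚ , -1<0 , atLeast-ι a) (ρ , ℚₚ.<-trans -1<0 0<ρ , p))) }
    where
    -1<0 : ℚ.- 1ℚ ℚ.+ 0ℚ ℚ.< 0ℚ
    -1<0 = ℚₚ.negative⁻¹ (ℚ.- 1ℚ)

  -- This is the transcendence of T: the value ⊤⁺ of 0 exceeds 0, which only the zero polynomial
  -- allows.
  v[T]=-1⇒fromF[t]-injective : v T ≡ [ ℚ.- 1ℚ ] → ∀ h →
    fromF[t] h ≈ 0# → ∀ i → F.coeff h i F.≈ F.0#
  v[T]=-1⇒fromF[t]-injective v-T h fh≈0 with v[T]=-1⇒zero⊎v≤0 v-T h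
  ... | inj₁ h≈0 = h≈0
  ... | inj₂ ¬e  = contradiction (exceeds-0 fh≈0) ¬e

-- The sums s_1 + ... + s_ℓ of an arithmetic progression.

progression-sum : ℕ → ℕ → ℕ → ℕ
progression-sum e c zero    = 0
progression-sum e c (suc ℓ) = c ℕ.+ progression-sum e (c ℕ.+ e) ℓ

progression-sum-monoˡ : ∀ e {c c′} ℓ → c ℕ.≤ c′ → progression-sum e c ℓ ℕ.≤ progression-sum e c′ ℓ
progression-sum-monoˡ e zero    c≤c′ = z≤n
progression-sum-monoˡ e (suc ℓ) c≤c′ =
  ℕₚ.+-mono-≤ c≤c′ (progression-sum-monoˡ e ℓ (ℕₚ.+-monoˡ-≤ e c≤c′))

progression-sum-monoʳ : ∀ e c {ℓ ℓ′} → ℓ ℕ.≤ ℓ′ → progression-sum e c ℓ ℕ.≤ progression-sum e c ℓ′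
progression-sum-monoʳ e c z≤n        = z≤n
progression-sum-monoʳ e c (s≤s ℓ≤ℓ′) = ℕₚ.+-monoʳ-≤ c (progression-sum-monoʳ e (c ℕ.+ e) ℓ≤ℓ′)

-- Gauss's formula, doubled to avoid a division and stated for `suc ℓ` to avoid the truncated ℓ - 1.
twice-progression-sum : ∀ e c ℓ →
  2 ℕ.* progression-sum e c (suc ℓ) ≡ suc ℓ ℕ.* (2 ℕ.* c ℕ.+ ℓ ℕ.* e)
twice-progression-sum e c zero    =
  solve 1 (λ c → con 2 :* (c :+ con 0) := con 1 :* (con 2 :* c :+ con 0)) ≡.refl c
  where open ℕSolver
twice-progression-sum e c (suc ℓ) = begin
  2 ℕ.* (c ℕ.+ progression-sum e (c ℕ.+ e) (suc ℓ))
    ≡⟨ ℕₚ.*-distribˡ-+ 2 c _ ⟩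
  2 ℕ.* c ℕ.+ 2 ℕ.* progression-sum e (c ℕ.+ e) (suc ℓ)
    ≡⟨ ≡.cong (2 ℕ.* c ℕ.+_) (twice-progression-sum e (c ℕ.+ e) ℓ) ⟩
  2 ℕ.* c ℕ.+ suc ℓ ℕ.* (2 ℕ.* (c ℕ.+ e) ℕ.+ ℓ ℕ.* e)
    ≡⟨ solve 3 (λ e c ℓ →
         con 2 :* c :+ (con 1 :+ ℓ) :* (con 2 :* (c :+ e) :+ ℓ :* e) :=
         (con 2 :+ ℓ) :* (con 2 :* c :+ (con 1 :+ ℓ) :* e)) ≡.refl e c ℓ ⟩
  suc (suc ℓ) ℕ.* (2 ℕ.* c ℕ.+ suc ℓ ℕ.* e)  ∎
  where
  open ℕSolver
  open ≡.≡-Reasoning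

-- Divisibility of the coefficients of a characteristic polynomial.

module CharacteristicPolynomial {q} {F : FiniteField q} (V : ValuedExtension F) (e : ℕ) where
  open ValuedExtension V hiding (zero; sum; _^_)
  open RawSemiringOps (RawRing.rawSemiring polyRing) using (sum; _^_)
  open ConstantField V
  open PolynomialArithmetic 𝕂

  -- An entry of X · 1 - A in a column of weight c. Membership in `[t^ 0 ]` just means lying in the
  -- image of 𝔽_q[t].
  record Entry (c : ℕ) (p : Poly) : Set where
    field
      constant : [t^ c ] (coeff p 0)
      leading  : [t^ 0 ] (coeff p 1)
      linear   : ∀ i → coeff p (2 ℕ.+ i) ≈ 0#

  -- In a term contributing to X^i, at least n - i columns supply their constant terms, and their
  -- weights add up to no less than the n - i smallest ones. For i ≥ n the truncated difference
  -- leaves the exponent 0.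
  record Minor (n c : ℕ) (p : Poly) : Set where
    field
      low    : ∀ i → [t^ progression-sum e c (n ∸ i) ] (coeff p i)
      degree : ∀ i → n ℕ.< i → coeff p i ≈ 0#

  open Entry
  open Minor

  minor-sum : ∀ {n c m} (f : Fin m → Poly) → (∀ i → Minor n c (f i)) → Minor n c (sum f)
  minor-sum {m = zero}  f h = record { low = λ _ → [t^]-0 refl ; degree = λ _ _ → refl }
  minor-sum {m = suc m} f h = record
    { low    = λ i → [t^]-cong (sym (coeff-+ₚ (f Fin.zero) _ i))
                       ([t^]-+ (low (h Fin.zero) i) (low rest i))
    ; degree = λ i n<i → trans (coeff-+ₚ (f Fin.zero) _ i)
        (trans (+-cong (degree (h Fin.zero) i n<i) (degree rest i n<i)) (+-identityʳ 0#))
    }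
    where
    rest : Minor _ _ (sum (f ∘ Fin.suc))
    rest = minor-sum (f ∘ Fin.suc) (h ∘ Fin.suc)

  -- The signs of the Laplace expansion are powers of the constant polynomial - 1, so multiplying by
  -- them only scales coefficients by an element of 𝔽_q[t].
  sign-constant : ∀ k → [t^ 0 ] (coeff ((-ₚ (1# ∷ [])) ^ k) 0) ×
                        (∀ i → coeff ((-ₚ (1# ∷ [])) ^ k) (suc i) ≈ 0#)
  sign-constant zero    = [t^0]-1 , λ _ → refl
  sign-constant (suc k) with sign-constant k
  ... | unit , const =
    [t^]-cong (sym (product 0)) ([t^]-* ([t^]-neg [t^0]-1) unit) ,
    λ i → trans (product (suc i)) (trans (*-congˡ (const i)) (zeroʳ _))
    where
    product : ∀ i → coeff ((-ₚ (1# ∷ [])) ^ suc k) i ≈ - 1# * coeff ((-ₚ (1# ∷ [])) ^ k) i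
    product = coeff-constant-*ₚ (-ₚ (1# ∷ [])) ((-ₚ (1# ∷ [])) ^ k) (λ _ → refl)

  signed-entry : ∀ {c p} k → Entry c p → Entry c ((-ₚ (1# ∷ [])) ^ k *ₚ p)
  signed-entry {c} {p} k h with sign-constant k
  ... | unit , const = record
    { constant = [t^]-cong (sym (product 0)) ([t^]-* unit (constant h))
    ; leading  = [t^]-cong (sym (product 1)) ([t^]-* unit (leading h))
    ; linear   = λ i → trans (product (2 ℕ.+ i)) (trans (*-congˡ (linear h i)) (zeroʳ _))
    }
    where
    product : ∀ i → coeff ((-ₚ (1# ∷ [])) ^ k *ₚ p) i ≈ coeff ((-ₚ (1# ∷ [])) ^ k) 0 * coeff p i
    product = coeff-constant-*ₚ ((-ₚ (1# ∷ [])) ^ k) p const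

  -- The leading coefficient of an entry multiplies a minor with the weights
  -- c + e, c + 2e, …, which dominate c, c + e, …
  entry-*-minor : ∀ {n c p p′} → Entry c p → Minor n (c ℕ.+ e) p′ → Minor (suc n) c (p *ₚ p′)
  entry-*-minor {n} {c} {p} {p′} h h′ = record { low = low* ; degree = degree* }
    where
    low-constant : ∀ i →
      [t^ progression-sum e c (n ∸ i) ] (coeff p 0 * coeff p′ (suc i))
    low-constant i with n ∸ i in n∸i≡
    -- Here n ≤ i and no power of t is demanded. In the other case the constant term gives the
    -- weight c and the minor the remaining n - i - 1 weights.
    ... | zero  = [t^]-weaken z≤n ([t^]-* (constant h) (low h′ (suc i)))
    ... | suc m = ≡.subst
      (λ ℓ → [t^ c ℕ.+ progression-sum e (c ℕ.+ e) ℓ ] (coeff p 0 * coeff p′ (suc i)))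
      (≡.trans (≡.sym (ℕₚ.pred[m∸n]≡m∸[1+n] n i)) (≡.cong ℕ.pred n∸i≡))
      ([t^]-* (constant h) (low h′ (suc i)))

    low* : ∀ i → [t^ progression-sum e c (suc n ∸ i) ] (coeff (p *ₚ p′) i)
    low* zero    = [t^]-cong (sym (coeff-*ₚ-zero p p′)) ([t^]-* (constant h) (low h′ 0))
    low* (suc i) = [t^]-cong (sym (coeff-linear-*ₚ p p′ (linear h) i))
      ([t^]-+ (low-constant i)
        ([t^]-weaken (progression-sum-monoˡ e (n ∸ i) (ℕₚ.m≤m+n c e))
                     ([t^]-* (leading h) (low h′ i))))

    degree* : ∀ i → suc n ℕ.< i → coeff (p *ₚ p′) i ≈ 0#
    degree* (suc i) (s≤s n<i) = trans (coeff-linear-*ₚ p p′ (linear h) i)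
      (trans (+-cong (trans (*-congˡ (degree h′ (suc i) (ℕₚ.m≤n⇒m≤1+n n<i))) (zeroʳ _))
                     (trans (*-congˡ (degree h′ i n<i)) (zeroʳ _)))
             (+-identityʳ 0#))

  -- Induction along the Laplace expansion. The weights depend on the column alone, so deleting a
  -- row is harmless and deleting the first column, the one of least weight, replaces c by c + e.
  det-minor : ∀ {n} c (A : Matrix Poly n) → (∀ a b → Entry (c ℕ.+ toℕ b ℕ.* e) (A a b)) →
              Minor n c (det polyRing A)
  det-minor {zero}  c A h = record
    { low    = λ { zero → [t^0]-1 ; (suc i) → [t^]-0 refl }
    ; degree = λ { (suc i) _ → refl }
    }
  det-minor {suc n} c A h = minor-sum _ λ i → entry-*-minor
    (signed-entry (toℕ i)
      (≡.subst (λ w → Entry w (A i Fin.zero)) (ℕₚ.+-identityʳ c) (h i Fin.zero)))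
    (det-minor (c ℕ.+ e) _ λ a b →
      ≡.subst (λ w → Entry w (A (punchIn i a) (Fin.suc b))) (≡.sym (ℕₚ.+-assoc c e _))
              (h (punchIn i a) (Fin.suc b)))

  -- The matrix of charPoly is built by a local function of Defs; the mutual block
  -- lets the first definition fix the metavariable in the type of the second.
  mutual
    charPoly-minor : ∀ {n} c (A : Matrix Carrier n) →
      (∀ a b → [t^ c ℕ.+ toℕ b ℕ.* e ] (A a b)) → Minor n c (charPoly rawRing A)
    charPoly-minor c A h = det-minor c _ (charPoly-entry c A h)

    charPoly-entry : ∀ {n} c (A : Matrix Carrier n) →
      (∀ a b → [t^ c ℕ.+ toℕ b ℕ.* e ] (A a b)) → ∀ a b → Entry (c ℕ.+ toℕ b ℕ.* e) _
    charPoly-entry c A h a b with a Fin.≟ b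
    ... | yes _ = record
      { constant = [t^]-cong (sym (+-identityˡ _)) ([t^]-neg (h a b))
      ; leading  = [t^0]-1
      ; linear   = λ _ → refl
      }
    ... | no  _ = record
      { constant = [t^]-neg (h a b)
      ; leading  = [t^]-0 refl
      ; linear   = λ _ → refl
      }

-- Supporting lines of the Newton polygon of ∏ (X - x).

module Slopes {q} {F : FiniteField q} (V : ValuedExtension F) (α : ℚ) where
  open ValuedExtension V hiding (zero)
  open Valuation V
  open PolynomialArithmetic 𝕂

  -- Recursive, to follow the recursion for the coefficients of (X - x) p; `line-value` gives the
  -- closed form.
  line : ℚ → ℕ → ℚ
  line C zero    = C
  line C (suc i) = line C i ℚ.- α

  line-+ : ∀ β C i → β ℚ.+ line C i ≡ line (C ℚ.+ β) i
  line-+ β C zero    = ℚₚ.+-comm β C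
  line-+ β C (suc i) = ≡.trans (≡.sym (ℚₚ.+-assoc β (line C i) (ℚ.- α))) (≡.cong (ℚ._- α) (line-+ β C i))

  -- Multiplication by X moves a Newton polygon one step to the right, which raises the intercept of
  -- its line of slope -α by α.
  line-suc : ∀ C i → line (C ℚ.+ α) (suc i) ≡ line C i
  line-suc C i = ≡.trans (≡.cong (ℚ._- α) (≡.trans (≡.sym (line-+ α C i)) (ℚₚ.+-comm α (line C i))))
    (≡.trans (ℚₚ.+-assoc (line C i) α (ℚ.- α))
      (≡.trans (≡.cong (line C i ℚ.+_) (ℚₚ.+-inverseʳ α)) (ℚₚ.+-identityʳ (line C i))))

  line-monoˡ : ∀ {C C′} i → C ℚ.≤ C′ → line C i ℚ.≤ line C′ i
  line-monoˡ zero    C≤C′ = C≤C′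
  line-monoˡ (suc i) C≤C′ = ℚₚ.+-monoˡ-≤ (ℚ.- α) (line-monoˡ i C≤C′)

  slope-multiplicity : List Carrier → ℕ
  slope-multiplicity xs = length (filter (λ x → ≡-dec ℚₚ._≟_ (v x) [ α ]) xs)

  -- The Newton polygon of p lies above the line of slope -α through its vertex of
  -- index g, and strictly above it to the left of g; g will be the number of roots
  -- of valuation > α.
  record Supports (p : Poly) (C : ℚ) (g : ℕ) : Set where
    field
      above    : ∀ i → AtLeast (line C i) (coeff p i)
      strictly : ∀ i → i ℕ.< g → Exceeds (line C i) (coeff p i)
      vertex   : ¬ Exceeds (line C g) (coeff p g)

  open Supports

  module _ (x : Carrier) {p : Poly} {C : ℚ} {g : ℕ} (h : Supports p C g) where

    private
      p′ : Poly
      p′ = (X +ₚ (-ₚ const x)) *ₚ p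

    -- The summand - x p lifts the line by β, and X p lifts it by α ≥ β, so the lower line supports
    -- the sum. At g the summand X p contributes a coefficient from the left of the old vertex,
    -- which is too large to disturb it.
    supports-small : ∀ {β} → v x ≡ [ β ] → β ℚ.≤ α → Supports p′ (C ℚ.+ β) g
    supports-small {β} vx≡β β≤α = record
      { above    = above′
      ; strictly = strictly′
      ; vertex   = vertex′ g ≡.refl
      }
      where
      v-x : v (- x) ≡ [ β ]
      v-x = ≡.trans (v-neg x) vx≡β

      line≤ : ∀ i → line (C ℚ.+ β) (suc i) ℚ.≤ line C i
      line≤ i = ≡.subst (line (C ℚ.+ β) (suc i) ℚ.≤_) (line-suc C i)
                        (line-monoˡ (suc i) (ℚₚ.+-monoʳ-≤ C β≤α))

      scaled : ∀ i → AtLeast (line (C ℚ.+ β) i) (- x * coeff p i)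
      scaled i = ≡.subst (λ ρ → AtLeast ρ (- x * coeff p i)) (line-+ β C i)
                         (atLeast-* (atLeast-v≡ v-x) (above h i))

      scaled-strictly : ∀ i → i ℕ.< g → Exceeds (line (C ℚ.+ β) i) (- x * coeff p i)
      scaled-strictly i i<g = ≡.subst (λ ρ → Exceeds ρ (- x * coeff p i)) (line-+ β C i)
                                      (exceeds-*ʳ (atLeast-v≡ v-x) (strictly h i i<g))

      scaled-vertex : ¬ Exceeds (line (C ℚ.+ β) g) (- x * coeff p g)
      scaled-vertex ex = vertex h (exceeds-cancel v-x
        (≡.subst (λ ρ → Exceeds ρ (- x * coeff p g)) (≡.sym (line-+ β C g)) ex))

      shifted-strictly : ∀ i → i ℕ.< g → Exceeds (line (C ℚ.+ β) (suc i)) (coeff p i)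
      shifted-strictly i i<g with strictly h i i<g
      ... | ρ , lt , le = ρ , ℚₚ.≤-<-trans (line≤ i) lt , le

      above′ : ∀ i → AtLeast (line (C ℚ.+ β) i) (coeff p′ i)
      above′ zero    = atLeast-cong (sym (coeff-[X- x ]*ₚ-zero p)) (scaled 0)
      above′ (suc i) = atLeast-cong (sym (coeff-[X- x ]*ₚ-suc p i))
        (v-+ [ _ ] _ _ (scaled (suc i)) (atLeast-weaken (line≤ i) (above h i)))

      strictly′ : ∀ i → i ℕ.< g → Exceeds (line (C ℚ.+ β) i) (coeff p′ i)
      strictly′ zero    i<g = exceeds-cong (sym (coeff-[X- x ]*ₚ-zero p)) (scaled-strictly 0 i<g)
      strictly′ (suc i) i<g = exceeds-cong (sym (coeff-[X- x ]*ₚ-suc p i))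
        (exceeds-+ (scaled-strictly (suc i) i<g) (shifted-strictly i (ℕₚ.<⇒≤ i<g)))

      -- The index is kept apart from the parameter g so that it can be split into zero and
      -- successor.
      vertex′ : ∀ i → i ≡ g → ¬ Exceeds (line (C ℚ.+ β) i) (coeff p′ i)
      vertex′ zero    ≡.refl ex = scaled-vertex (exceeds-cong (coeff-[X- x ]*ₚ-zero p) ex)
      vertex′ (suc i) ≡.refl ex = scaled-vertex (exceeds-+-cancelʳ (shifted-strictly i ℕₚ.≤-refl)
        (exceeds-cong (coeff-[X- x ]*ₚ-suc p i) ex))

    -- Now - x p lies strictly above the line lifted by α, so X p dominates and carries the vertex
    -- from g to g + 1.
    supports-large : Exceeds α x → Supports p′ (C ℚ.+ α) (suc g)
    supports-large α<vx = record { above = above′ ; strictly = strictly′ ; vertex = vertex′ }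
      where
      scaled : ∀ i → Exceeds (line (C ℚ.+ α) i) (- x * coeff p i)
      scaled i = ≡.subst (λ ρ → Exceeds ρ (- x * coeff p i)) (line-+ α C i)
                         (exceeds-*ˡ (exceeds-neg α<vx) (above h i))

      above′ : ∀ i → AtLeast (line (C ℚ.+ α) i) (coeff p′ i)
      above′ zero    = atLeast-cong (sym (coeff-[X- x ]*ₚ-zero p)) (exceeds⇒atLeast (scaled 0))
      above′ (suc i) = atLeast-cong (sym (coeff-[X- x ]*ₚ-suc p i))
        (v-+ [ _ ] _ _ (exceeds⇒atLeast (scaled (suc i)))
          (≡.subst (λ ρ → AtLeast ρ (coeff p i)) (≡.sym (line-suc C i)) (above h i)))

      strictly′ : ∀ i → i ℕ.< suc g → Exceeds (line (C ℚ.+ α) i) (coeff p′ i)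
      strictly′ zero    _         = exceeds-cong (sym (coeff-[X- x ]*ₚ-zero p)) (scaled 0)
      strictly′ (suc i) (s≤s i<g) = exceeds-cong (sym (coeff-[X- x ]*ₚ-suc p i))
        (exceeds-+ (scaled (suc i))
          (≡.subst (λ ρ → Exceeds ρ (coeff p i)) (≡.sym (line-suc C i)) (strictly h i i<g)))

      vertex′ : ¬ Exceeds (line (C ℚ.+ α) (suc g)) (coeff p′ (suc g))
      vertex′ ex = vertex h (≡.subst (λ ρ → Exceeds ρ (coeff p g)) (line-suc C g)
        (exceeds-+-cancelˡ (scaled (suc g)) (exceeds-cong (coeff-[X- x ]*ₚ-suc p g) ex)))

  record Polygon (xs : List Carrier) : Set where
    field
      C        : ℚ
      g        : ℕ
      supports : Supports (fromRoots xs) C g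
      C≤       : C ℚ.≤ fromℕ (length xs) ℚ.* α
      slopes≤  : slope-multiplicity xs ℕ.+ g ℕ.≤ length xs

  [1+n]α≡nα+α : ∀ n → fromℕ (suc n) ℚ.* α ≡ fromℕ n ℚ.* α ℚ.+ α
  [1+n]α≡nα+α n = ≡.trans (≡.cong (ℚ._* α) (≡.trans (fromℕ-+ 1 n) (ℚₚ.+-comm 1ℚ (fromℕ n))))
    (≡.trans (ℚₚ.*-distribʳ-+ α (fromℕ n) 1ℚ) (≡.cong (fromℕ n ℚ.* α ℚ.+_) (ℚₚ.*-identityˡ α)))

  -- A root 0, of value ⊤⁺, counts as large. The inequality with [ α ] is recorded because the
  -- filter in `slope-multiplicity` tests equality.
  small-or-large : ∀ x → (∃ λ β → v x ≡ [ β ] × β ℚ.≤ α) ⊎ (v x ≢ [ α ] × Exceeds α x)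
  small-or-large x = compare (v x) ≡.refl
    where
    compare : ∀ y → v x ≡ y → (∃ λ β → v x ≡ [ β ] × β ℚ.≤ α) ⊎ (v x ≢ [ α ] × Exceeds α x)
    compare ⊤⁺ vx≡⊤ = inj₂ ((λ vx≡α → case ≡.trans (≡.sym vx≡⊤) vx≡α of λ ()) ,
                            exceeds-0 (Equivalence.to (v-∞ x) vx≡⊤))
    compare [ β ] vx≡β with β ℚ.≤? α
    ... | yes β≤α = inj₁ (β , vx≡β , β≤α)
    ... | no  β≰α = inj₂ ((λ vx≡α → β≰α (NonStrict.[≤]-injective
                             (NonStrict.≤⁺-reflexive-≡ ℚₚ.≤-reflexive (≡.trans (≡.sym vx≡β) vx≡α)))) ,
                          β , ℚₚ.≰⇒> β≰α , atLeast-v≡ vx≡β)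

  multiplicity-∷-≤ : ∀ x xs → slope-multiplicity (x ∷ xs) ℕ.≤ suc (slope-multiplicity xs)
  multiplicity-∷-≤ x xs with ≡-dec ℚₚ._≟_ (v x) [ α ]
  ... | yes _ = ℕₚ.≤-refl
  ... | no  _ = ℕₚ.n≤1+n _

  -- `C` accumulates min (v x, α), whence `C≤`; `g` counts the large roots, none of which has
  -- valuation α, whence `slopes≤`.
  polygon : ∀ xs → Polygon xs
  polygon [] = record
    { C        = 0ℚ
    ; g        = 0
    ; supports = record
      { above    = λ { zero → atLeast-v≡ v-1 ; (suc i) → atLeast-0 refl }
      ; strictly = λ _ ()
      ; vertex   = λ ex → ℚₚ.<-irrefl ≡.refl (exceeds⇒< v-1 ex)
      }
    ; C≤       = ℚₚ.≤-reflexive (≡.sym (ℚₚ.*-zeroˡ α))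
    ; slopes≤  = z≤n
    }
  polygon (x ∷ xs) with polygon xs | small-or-large x
  ... | record { C = C ; g = g ; supports = h ; C≤ = C≤ ; slopes≤ = s≤ }
      | inj₁ (β , vx≡β , β≤α) = record
    { C        = C ℚ.+ β
    ; g        = g
    ; supports = supports-small x h vx≡β β≤α
    ; C≤       = ℚₚ.≤-trans (ℚₚ.+-mono-≤ C≤ β≤α)
        (ℚₚ.≤-reflexive (≡.sym ([1+n]α≡nα+α (length xs))))
    ; slopes≤  = ℕₚ.≤-trans (ℕₚ.+-monoˡ-≤ g (multiplicity-∷-≤ x xs)) (s≤s s≤)
    }
  ... | record { C = C ; g = g ; supports = h ; C≤ = C≤ ; slopes≤ = s≤ }
      | inj₂ (vx≢α , α<vx) = record
    { C        = C ℚ.+ α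
    ; g        = suc g
    ; supports = supports-large x h α<vx
    ; C≤       = ℚₚ.≤-trans (ℚₚ.+-monoˡ-≤ α C≤)
        (ℚₚ.≤-reflexive (≡.sym ([1+n]α≡nα+α (length xs))))
    ; slopes≤  = ≡.subst (λ zs → length zs ℕ.+ suc g ℕ.≤ suc (length xs))
                         (≡.sym (filter-reject (λ y → ≡-dec ℚₚ._≟_ (v y) [ α ]) vx≢α))
                         (≡.subst (ℕ._≤ suc (length xs)) (≡.sym (ℕₚ.+-suc _ g)) (s≤s s≤))
    }

  line-value : ∀ C i → line C i ≡ C ℚ.- fromℕ i ℚ.* α
  line-value C zero    = ≡.sym (≡.trans (≡.cong (λ ρ → C ℚ.- ρ) (ℚₚ.*-zeroˡ α)) (ℚₚ.+-identityʳ C))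
  line-value C (suc i) = begin
    line C i ℚ.- α                        ≡⟨ ≡.cong (ℚ._- α) (line-value C i) ⟩
    C ℚ.- fromℕ i ℚ.* α ℚ.- α             ≡⟨ ℚₚ.+-assoc C _ (ℚ.- α) ⟩
    C ℚ.+ (ℚ.- (fromℕ i ℚ.* α) ℚ.- α)     ≡⟨ ≡.cong (C ℚ.+_) (ℚₚ.neg-distrib-+ (fromℕ i ℚ.* α) α) ⟨
    C ℚ.- (fromℕ i ℚ.* α ℚ.+ α)           ≡⟨ ≡.cong (λ ρ → C ℚ.- ρ) ([1+n]α≡nα+α i) ⟨
    C ℚ.- fromℕ (suc i) ℚ.* α             ∎
    where open ≡.≡-Reasoning

-- From the inequality for N to the bound on the multiplicity.

n*1/n≡1 : ∀ n .{{_ : ℕ.NonZero n}} → fromℕ n ℚ.* (+ 1 / n) ≡ 1ℚ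
n*1/n≡1 n@(suc n-1) = ℚₚ.toℚᵘ-injective (begin
  ℚ.toℚᵘ (fromℕ n ℚ.* (+ 1 / n))            ≈⟨ ℚₚ.toℚᵘ-homo-* (fromℕ n) (+ 1 / n) ⟩
  ℚ.toℚᵘ (fromℕ n) ℚᵘ.* ℚ.toℚᵘ (+ 1 / n)
    ≈⟨ ℚᵘₚ.*-cong (ℚₚ.toℚᵘ-fromℚᵘ (mkℚᵘ (+ n) 0)) (ℚₚ.toℚᵘ-fromℚᵘ (mkℚᵘ (+ 1) n-1)) ⟩
  mkℚᵘ (+ n) 0 ℚᵘ.* mkℚᵘ (+ 1) n-1          ≈⟨ ℚᵘₚ.*-inverseʳ (mkℚᵘ (+ n) 0) ⟩
  ℚ.toℚᵘ 1ℚ                                 ∎)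
  where open ℚᵘₚ.≃-Reasoning

-- With N = M + 1, doubling the hypothesis and cancelling N leaves 2 (j + 1) + M e ≤ 2 α, which is
-- solved for M; then d ≤ M + 1. For N = 0 the hypothesis would only read 0 ≤ 0.
slope-bound : ∀ e .{{_ : ℕ.NonZero e}} j N d α → 1 ℕ.≤ N → d ℕ.≤ N →
  fromℕ (progression-sum e (j ℕ.+ 1) N) ℚ.≤ fromℕ N ℚ.* α →
  fromℕ d ℚ.≤ fromℕ 2 ℚ.* ((α ℚ.- fromℕ j ℚ.- 1ℚ) ÷ℕ e) ℚ.+ 1ℚ
slope-bound e j N@(suc M) d α _ d≤N Σ≤Nα = begin
  fromℕ d                                                     ≤⟨ fromℕ-mono-≤ d≤N ⟩
  fromℕ (1 ℕ.+ M)                                             ≡⟨ fromℕ-+ 1 M ⟩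
  1ℚ ℚ.+ fromℕ M                                              ≡⟨ ℚₚ.+-comm 1ℚ (fromℕ M) ⟩
  fromℕ M ℚ.+ 1ℚ                                              ≤⟨ ℚₚ.+-monoˡ-≤ 1ℚ M≤ ⟩
  fromℕ 2 ℚ.* ((α ℚ.- fromℕ j ℚ.- 1ℚ) ÷ℕ e) ℚ.+ 1ℚ            ∎
  where
  open ℚₚ.≤-Reasoning

  2c+Me≤2α : fromℕ 2 ℚ.* (fromℕ j ℚ.+ 1ℚ) ℚ.+ fromℕ M ℚ.* fromℕ e ℚ.≤ fromℕ 2 ℚ.* α
  2c+Me≤2α = ℚₚ.*-cancelˡ-≤-pos (fromℕ N) {{ℚₚ.normalize-pos N 1}} (begin
    fromℕ N ℚ.* (fromℕ 2 ℚ.* (fromℕ j ℚ.+ 1ℚ) ℚ.+ fromℕ M ℚ.* fromℕ e)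
      ≡⟨ ≡.cong₂ (λ x y → fromℕ N ℚ.* (x ℚ.+ y))
           (≡.trans (≡.cong (fromℕ 2 ℚ.*_) (≡.sym (fromℕ-+ j 1))) (≡.sym (fromℕ-* 2 (j ℕ.+ 1))))
           (≡.sym (fromℕ-* M e)) ⟩
    fromℕ N ℚ.* (fromℕ (2 ℕ.* (j ℕ.+ 1)) ℚ.+ fromℕ (M ℕ.* e))
      ≡⟨ ≡.cong (fromℕ N ℚ.*_) (fromℕ-+ (2 ℕ.* (j ℕ.+ 1)) (M ℕ.* e)) ⟨
    fromℕ N ℚ.* fromℕ (2 ℕ.* (j ℕ.+ 1) ℕ.+ M ℕ.* e)
      ≡⟨ fromℕ-* N (2 ℕ.* (j ℕ.+ 1) ℕ.+ M ℕ.* e) ⟨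
    fromℕ (N ℕ.* (2 ℕ.* (j ℕ.+ 1) ℕ.+ M ℕ.* e))
      ≡⟨ ≡.cong fromℕ (twice-progression-sum e (j ℕ.+ 1) M) ⟨
    fromℕ (2 ℕ.* progression-sum e (j ℕ.+ 1) N)
      ≡⟨ fromℕ-* 2 (progression-sum e (j ℕ.+ 1) N) ⟩
    fromℕ 2 ℚ.* fromℕ (progression-sum e (j ℕ.+ 1) N)
      ≤⟨ ℚₚ.*-monoˡ-≤-nonNeg (fromℕ 2) Σ≤Nα ⟩
    fromℕ 2 ℚ.* (fromℕ N ℚ.* α)
      ≡⟨ solve 2 (λ n a → con (fromℕ 2) :* (n :* a) := n :* (con (fromℕ 2) :* a)) ≡.refl (fromℕ N) α ⟩
    fromℕ N ℚ.* (fromℕ 2 ℚ.* α)  ∎)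
    where open ℚSolver

  M≤ : fromℕ M ℚ.≤ fromℕ 2 ℚ.* ((α ℚ.- fromℕ j ℚ.- 1ℚ) ÷ℕ e)
  M≤ = begin
    fromℕ M
      ≡⟨ ℚₚ.*-identityʳ (fromℕ M) ⟨
    fromℕ M ℚ.* 1ℚ
      ≡⟨ ≡.cong (fromℕ M ℚ.*_) (n*1/n≡1 e) ⟨
    fromℕ M ℚ.* (fromℕ e ℚ.* (+ 1 / e))
      -- The term 2 (j + 1) is added and subtracted so that `2c+Me≤2α` applies.
      ≡⟨ solve 4 (λ m e r c → m :* (e :* r) := (c :+ m :* e :- c) :* r) ≡.refl
           (fromℕ M) (fromℕ e) (+ 1 / e) (fromℕ 2 ℚ.* (fromℕ j ℚ.+ 1ℚ)) ⟩
    (fromℕ 2 ℚ.* (fromℕ j ℚ.+ 1ℚ) ℚ.+ fromℕ M ℚ.* fromℕ e ℚ.- fromℕ 2 ℚ.* (fromℕ j ℚ.+ 1ℚ)) ℚ.* (+ 1 / e)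
      ≤⟨ ℚₚ.*-monoʳ-≤-nonNeg (+ 1 / e) {{ℚₚ.normalize-nonNeg 1 e}}
           (ℚₚ.+-monoˡ-≤ (ℚ.- (fromℕ 2 ℚ.* (fromℕ j ℚ.+ 1ℚ))) 2c+Me≤2α) ⟩
    (fromℕ 2 ℚ.* α ℚ.- fromℕ 2 ℚ.* (fromℕ j ℚ.+ 1ℚ)) ℚ.* (+ 1 / e)
      ≡⟨ solve 3 (λ a j r → (con (fromℕ 2) :* a :- con (fromℕ 2) :* (j :+ con 1ℚ)) :* r :=
                            con (fromℕ 2) :* ((a :- j :- con 1ℚ) :* r)) ≡.refl α (fromℕ j) (+ 1 / e) ⟩
    fromℕ 2 ℚ.* ((α ℚ.- fromℕ j ℚ.- 1ℚ) ÷ℕ e)  ∎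
    where open ℚSolver

-- Passage from ℂ_∞ through 𝔽_q[t] to the t-adic side.

coeff-baseChange : ∀ {q} {F : FiniteField q} (V : ValuedExtension F) (P : F[t][X] F) i →
  ValuedExtension.coeff V (baseChange V P) i ≡
  ValuedExtension.fromF[t] V (Polynomials.coeff (FiniteField.polyRing F) P i)
coeff-baseChange V []      i       = ≡.refl
coeff-baseChange V (p ∷ P) zero    = ≡.refl
coeff-baseChange V (p ∷ P) (suc i) = coeff-baseChange V P i

module Transfer {q} {F : FiniteField q} (V W : ValuedExtension F)
                (v-T : ValuedExtension.v V (ValuedExtension.T V) ≡ [ ℚ.- 1ℚ ])
                (w-T : ValuedExtension.v W (ValuedExtension.T W) ≡ [ 1ℚ ]) where
  private
    module F  = FiniteField F
    module V  = ValuedExtension V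
    module W  = ValuedExtension W
    module CV = ConstantField V
    module CW = ConstantField W
  open MonomialMultiples F

  -- T is transcendental in `V`, so a polynomial vanishing there has zero coefficients and vanishes
  -- in every extension.
  transfer-0 : ∀ h → V.fromF[t] h V.≈ V.0# → W.fromF[t] h W.≈ W.0#
  transfer-0 h h≈0 = CW.fromF[t]-zero h (CV.v[T]=-1⇒fromF[t]-injective v-T h h≈0)

  transfer-≈ : ∀ g h → V.fromF[t] g V.≈ V.fromF[t] h → W.fromF[t] g W.≈ W.fromF[t] h
  transfer-≈ g h g≈h = GroupProperties.x∙y⁻¹≈ε⇒x≈y W.+-group _ _
    (W.trans (W.+-congˡ (W.sym (CW.fromF[t]-neg h)))
    (W.trans (W.sym (CW.fromF[t]-+ g (F.-ₚ h)))
             (transfer-0 (g F.+ₚ (F.-ₚ h)) (V.trans (CV.fromF[t]-+ g (F.-ₚ h))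
               (V.trans (V.+-cong g≈h (CV.fromF[t]-neg h)) (V.-‿inverseʳ _))))))

  -- The cofactor h has coefficients in 𝔽_q, so the equation g = t^S h carries over from `V` to `W`,
  -- where T has valuation 1.
  transfer-[t^] : ∀ {S} g → CV.[t^ S ] (V.fromF[t] g) → Valuation.AtLeast W (fromℕ S) (W.fromF[t] g)
  transfer-[t^] {S} g g∈ = Valuation.atLeast-cong W
    (W.sym (transfer-≈ g (t^ S · h) (V.trans (CV.[t^_].equation g∈) (V.sym (CV.fromF[t]-t^ S h)))))
    (CW.v[T]=1⇒v-t^ w-T S h)
    where h = CV.[t^_].cofactor g∈

-- Comparison of both estimates at the vertex g.

open import Data.Nat using (_+_; _*_; _^_; _≤_)

theorem6p5 : (p r q : ℕ) (p-prime : Prime p) (1≤r : 1 ≤ r) (q≡p^r : q ≡ p ^ r)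
    (F : FiniteField q)
    (j n k : ℕ) (m : ℤ) →
    j ≤ q ∸ 2 →
    1 ≤ n →
    k ≡ 2 * j + 2 + (n ∸ 1) * (q ∸ 1) →
    (+ (q ∸ 1)) ∣ (m ℤ.- + (j + 1)) →
    (ℂ∞ : ValuedExtension F) → IsℂInfinity ℂ∞ →
    (let open DrinfeldCuspForms ℂ∞) →
    UHasMatrix k m (AtkinMatrix.MD F n j ℂ∞) →
    (P : F[t][X] F) → IsCharPolyOfU k m (baseChange ℂ∞ P) →
    (L : ValuedExtension F) → IsAlgebraicClosureOf𝔽⸨t⸩ L →
    (α : ℚ) (d : ℕ) → HasRootsOfValuation L P α d →
    1 ≤ d →
    (+ d / 1) ℚ.≤ (+ 2 / 1) ℚ.* ((α ℚ.- (+ j / 1) ℚ.- 1ℚ) ÷ℕ (q ∸ 1)) {{q∸1-nonZero p-prime 1≤r q≡p^r}} ℚ.+ 1ℚ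
theorem6p5 p r q p-prime 1≤r q≡p^r F j n k m _ _ _ _ ℂ∞ isℂ∞ (basis , isBasis , isMatrix)
           P isCharPoly L isL α d (roots , P≈roots , multiplicity≡d) 1≤d =
  slope-bound (q ∸ 1) {{q∸1-nonZero p-prime 1≤r q≡p^r}} j N d α (ℕₚ.≤-trans 1≤d d≤N) d≤N (begin
    fromℕ (Σ N)
      -- The determinant provides n - g weights, at least N of them because there are at most n
      -- roots.
      ≤⟨ fromℕ-mono-≤ (progression-sum-monoʳ (q ∸ 1) (j + 1) (ℕₚ.∸-monoˡ-≤ g roots≤n)) ⟩
    fromℕ (Σ (n ∸ g))
      -- The same coefficient of X^g is bounded below by the determinant and above by the vertex.
      ≤⟨ L.atLeast∧¬exceeds above (Slopes.Supports.vertex supports) ⟩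
    Slopes.line L α C g
      ≡⟨ Slopes.line-value L α C g ⟩
    C ℚ.- fromℕ g ℚ.* α
      ≤⟨ ℚₚ.+-monoˡ-≤ (ℚ.- (fromℕ g ℚ.* α)) C≤ ⟩
    fromℕ (length roots) ℚ.* α ℚ.- fromℕ g ℚ.* α
      ≡⟨ ≡.cong (λ i → fromℕ i ℚ.* α ℚ.- fromℕ g ℚ.* α) (ℕₚ.m∸n+n≡m g≤roots) ⟨
    fromℕ (N + g) ℚ.* α ℚ.- fromℕ g ℚ.* α
      ≡⟨ ≡.cong (λ x → x ℚ.* α ℚ.- fromℕ g ℚ.* α) (fromℕ-+ N g) ⟩
    (fromℕ N ℚ.+ fromℕ g) ℚ.* α ℚ.- fromℕ g ℚ.* α
      ≡⟨ solve 3 (λ N g a → (N :+ g) :* a :- g :* a := N :* a) ≡.refl (fromℕ N) (fromℕ g) α ⟩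
    fromℕ N ℚ.* α  ∎)
  where
  module L where
    open ValuedExtension L public
    open Valuation L public
    open PolynomialArithmetic 𝕂 public
  module ℂ∞ = ValuedExtension ℂ∞
  open DrinfeldCuspForms ℂ∞ using (module IsCharPolyOfU)
  open Slopes.Polygon (Slopes.polygon L α roots)
  open CharacteristicPolynomial ℂ∞ (q ∸ 1)
  open ConstantField ℂ∞ using ([t^]-ι; [t^]-cong)
  open Transfer ℂ∞ L (IsℂInfinity.v-T isℂ∞) (IsAlgebraicClosureOf𝔽⸨t⸩.v-T isL)
  open ℚₚ.≤-Reasoning
  open ℚSolver

  N : ℕ
  N = length roots ∸ g

  Σ : ℕ → ℕ
  Σ = progression-sum (q ∸ 1) (j + 1)

  P[_] : ℕ → FiniteField.Poly F
  P[ i ] = Polynomials.coeff (FiniteField.polyRing F) P i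

  -- Column b of MD consists of constants times T^(s b), and s b is by definition the weight of that
  -- column.
  minor : Minor n (j + 1) (charPoly ℂ∞.rawRing (AtkinMatrix.MD F n j ℂ∞))
  minor = charPoly-minor (j + 1) _ λ a b → [t^]-ι (AtkinMatrix.M F n j a b) (AtkinMatrix.s F n j b)

  coeff-charPoly : ∀ i →
    ℂ∞.fromF[t] P[ i ] ℂ∞.≈ ℂ∞.coeff (charPoly ℂ∞.rawRing (AtkinMatrix.MD F n j ℂ∞)) i
  coeff-charPoly i = ℂ∞.trans (ℂ∞.sym (ℂ∞.reflexive (coeff-baseChange ℂ∞ P i)))
    (IsCharPolyOfU.char-poly isCharPoly basis _ isBasis isMatrix i)

  coeff-roots : ∀ i → L.fromF[t] P[ i ] L.≈ L.coeff (L.fromRoots roots) i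
  coeff-roots i = L.trans (L.sym (L.reflexive (coeff-baseChange L P i))) (P≈roots i)

  above : L.AtLeast (fromℕ (Σ (n ∸ g))) (L.coeff (L.fromRoots roots) g)
  above = L.atLeast-cong (coeff-roots g) (transfer-[t^] P[ g ]
    ([t^]-cong (ℂ∞.sym (coeff-charPoly g)) (Minor.low minor g)))

  -- The characteristic polynomial has no coefficients beyond index n, whereas `fromRoots roots` has
  -- leading coefficient 1 at `length roots`.
  roots≤n : length roots ≤ n
  roots≤n = ℕₚ.≮⇒≥ λ n<roots → L.0≉1 (L.trans
    (L.sym (transfer-0 P[ length roots ]
      (ℂ∞.trans (coeff-charPoly (length roots)) (Minor.degree minor (length roots) n<roots))))
    (L.trans (coeff-roots (length roots)) (L.fromRoots-monic roots)))

  d+g≤roots : d + g ≤ length roots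
  d+g≤roots = ≡.subst (λ x → x + g ≤ length roots) multiplicity≡d slopes≤

  g≤roots : g ≤ length roots
  g≤roots = ℕₚ.m+n≤o⇒n≤o d d+g≤roots

  d≤N : d ≤ N
  d≤N = ℕₚ.m+n≤o⇒m≤o∸n d d+g≤roots
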